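{- Let $\ell \ge -1$ be an integer, and let $P$ be an $(n+\ell)$-stable property for which $n(P)$ exists. Let $r\ge 3$ and let $n \ge n(P)$ be integers. Suppose that $n$ satisfies $$n \ge \begin{cases} 6\ell+26 & \text{if } r=3\\ \max\left\{3+ \ell + \frac{4(\ell+2)}{r-3},\;5+\ell+\frac{r+2\ell+7}{2r-2}\right\} & \text{if } 4 \le r \le 7\\ \ell+5+\frac{4(\ell+4)}{r-4} & \text{if } r \ge 8,\end{cases}$$ and in addition: - if $r=4$, then $n > 13-\ell$; - if $\ell=-1$ and $5\le r\le 7$, then $n>5$; - if $\ell\ge 0$ and $r=5$, then $n>\min\{17-\ell,\,10\ell+10\}$; - if $\ell\ge 0$ and $6\le r\le 7$, then $n>\min\{4r-3-\ell,\,6\ell+6\}$. Let $G$ be an $n$-vertex, $K_{r+1}$-free graph that does not have $P$. Then $$e(G) \leq e(T_r(n-1)) + (\ell+1).$$ The set $\mathcal{G}_{n,r}^{\ell}$ is nonempty, and if equality holds then $G \in \mathcal{G}_{n,r}^{\ell}$. If at least one graph in $\mathcal{G}_{n,r}^{\ell}$ does not have $P$, then the bound is tight.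
   Context: Graphs are finite and simple; $e(G)$ is the number of edges and $d_G(v)$ the degree of $v$ in $G$. For $s>0$, a property $P$ defined on all $n$-vertex graphs is $s$-stable if whenever $u,v$ are distinct nonadjacent vertices of an $n$-vertex graph $G$ such that $G+uv$ has $P$ and $d_G(u)+d_G(v)\ge s$, then $G$ itself has $P$. Here $(n+\ell)$-stable means $s=n+\ell$, where $n$ is the number of vertices. $n(P)$ denotes an integer such that each complete graph $K_n$ with $n\ge n(P)$ has property $P$, when such a value exists. $T_r(n)$ is the $n$-vertex, $r$-partite Turán graph: the complete $r$-partite graph on $n$ vertices with part sizes differing by at most 1 (if $n<r$ some parts are empty and it is $K_n$). $\mathcal{G}_{n,r}^{\ell}$ is the set of $n$-vertex, $K_{r+1}$-free graphs consisting of $T_r(n-1)$ plus one additional vertex of degree $\ell+1$. "Tight" means that equality is attained by some $n$-vertex, $K_{r+1}$-free graph not having $P$. -}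

module Defs where

open import Data.Bool.Base using (Bool; false; T; not; _∧_; _∨_)
open import Data.Bool.Properties using (∨-comm)
open import Data.Fin.Base using (Fin; toℕ; punchIn)
open import Data.Fin.Permutation using (Permutation′; _⟨$⟩ʳ_)
open import Data.Fin.Properties using (_≟_)
open import Data.Fin.Subset using (Subset; ∣_∣)
open import Data.Integer.Base as ℤ using (ℤ; +_; -1ℤ; 0ℤ)
open import Data.Nat.Base as ℕ using (ℕ; suc; pred; NonZero)
open import Data.Nat.DivMod using (_mod_)
open import Data.Nat.Properties using (+-0-commutativeMonoid)
open import Data.Product.Base using (_×_; ∃; ∃-syntax; _,_)
open import Data.Rational.Unnormalised.Base as ℚ using (ℚᵘ)
open import Data.Vec.Base using (tabulate)
open import Algebra.Properties.CommutativeMonoid.Sum +-0-commutativeMonoid using (sum)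
open import Function.Base using (id)
open import Function.Definitions using (Injective)
open import Level using (Level) renaming (suc to lsuc)
open import Relation.Binary.PropositionalEquality
  using (_≡_; _≢_; refl; sym; cong; cong₂; ≢-sym)
open import Relation.Nullary.Decidable.Core using (yes; no; does)
open import Relation.Nullary.Decidable using (dec-true; dec-false)
open import Relation.Nullary.Negation.Core using (¬_)

record Graph (n : ℕ) : Set where
  field
    adj        : Fin n → Fin n → Bool
    adj-sym    : ∀ u v → adj u v ≡ adj v u
    adj-irrefl : ∀ u → adj u u ≡ false

open Graph public

Adj : ∀ {n} → Graph n → Fin n → Fin n → Set
Adj G u v = T (adj G u v)

neighbours : ∀ {n} → Graph n → Fin n → Subset n
neighbours G u = tabulate (adj G u)

deg : ∀ {n} → Graph n → Fin n → ℕ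
deg G u = ∣ neighbours G u ∣

-- Every edge is counted once, at its smaller endpoint.
e : ∀ {n} → Graph n → ℕ
e G = sum λ u → ∣ tabulate (λ v → (toℕ u ℕ.<ᵇ toℕ v) ∧ adj G u v) ∣

_≅_ : ∀ {n} → Graph n → Graph n → Set
_≅_ {n} G H = ∃[ π ] (∀ u v → adj G u v ≡ adj H (π ⟨$⟩ʳ u) (π ⟨$⟩ʳ v))

infix 4 _≅_ _⊑_

-- H ⊑ G: G has a (not necessarily induced) subgraph isomorphic to H.
_⊑_ : ∀ {m n} → Graph m → Graph n → Set
_⊑_ {m} {n} H G = ∃ λ (f : Fin m → Fin n) →
  Injective _≡_ _≡_ f × (∀ u v → Adj H u v → Adj G (f u) (f v))

completeMultipartite : ∀ {r n} → (Fin n → Fin r) → Graph n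
completeMultipartite part = record
  { adj        = λ u v → not (does (part u ≟ part v))
  ; adj-sym    = λ u v → cong not (does-≟-sym (part u) (part v))
  ; adj-irrefl = λ u → cong not (dec-true (part u ≟ part u) refl)
  }
  where
  does-≟-sym : ∀ {k} (i j : Fin k) → does (i ≟ j) ≡ does (j ≟ i)
  does-≟-sym i j with i ≟ j
  ... | yes i≡j = sym (dec-true (j ≟ i) (sym i≡j))
  ... | no  i≢j = sym (dec-false (j ≟ i) (≢-sym i≢j))

K : ∀ n → Graph n
K n = completeMultipartite id

CliqueFree : ∀ {n} → ℕ → Graph n → Set
CliqueFree k G = ¬ (K k ⊑ G)

-- The parts are the residue classes modulo r of 0, …, n-1; each of the r
-- classes has ⌊n/r⌋ or ⌈n/r⌉ elements (none for the last ones if n < r).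
turán : ∀ r n → .{{_ : NonZero r}} → Graph n
turán r n = completeMultipartite (λ (u : Fin n) → toℕ u mod r)

addEdge : ∀ {n} (G : Graph n) (u v : Fin n) → u ≢ v → Graph n
addEdge G u v u≢v = record
  { adj        = λ x y → adj G x y ∨ (pair x y ∨ pair y x)
  ; adj-sym    = λ x y → cong₂ _∨_ (adj-sym G x y) (∨-comm (pair x y) (pair y x))
  ; adj-irrefl = λ x → cong₂ _∨_ (adj-irrefl G x) (cong₂ _∨_ (pair-irrefl x) (pair-irrefl x))
  }
  where
  pair : Fin _ → Fin _ → Bool
  pair x y = does (x ≟ u) ∧ does (y ≟ v)

  pair-irrefl : ∀ x → pair x x ≡ false
  pair-irrefl x with x ≟ u
  ... | yes refl = dec-false (x ≟ v) u≢v
  ... | no  _    = refl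

infixl 6 _─_

_─_ : ∀ {n} → Graph n → Fin n → Graph (pred n)
_─_ {suc _} G v = record
  { adj        = λ x y → adj G (punchIn v x) (punchIn v y)
  ; adj-sym    = λ x y → adj-sym G (punchIn v x) (punchIn v y)
  ; adj-irrefl = λ x → adj-irrefl G (punchIn v x)
  }

-- A property is one of graphs up to isomorphism, not of their labellings.
record GraphProperty (p : Level) : Set (lsuc p) where
  field
    holds      : ∀ {n} → Graph n → Set p
    holds-resp : ∀ {n} {G H : Graph n} → G ≅ H → holds G → holds H

open GraphProperty public

-- s-stability among the n-vertex graphs.
Stable : ∀ {p} (n : ℕ) (s : ℤ) → GraphProperty p → Set p
Stable n s P = ∀ (G : Graph n) (u v : Fin n) (u≢v : u ≢ v) →
  ¬ Adj G u v →
  holds P (addEdge G u v u≢v) →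
  + (deg G u ℕ.+ deg G v) ℤ.≥ s →
  holds P G

-- P is (n + ℓ)-stable, n being the number of vertices.  Positivity of n + ℓ
-- need not be imposed: for ℓ ≥ -1 it fails only if n ≤ 1, where there are no
-- two distinct vertices.
[n+_]-Stable : ∀ {p} → ℤ → GraphProperty p → Set p
[n+ ℓ ]-Stable P = ∀ n → Stable n (+ n ℤ.+ ℓ) P

HoldsOnCompleteFrom : ∀ {p} → ℤ → GraphProperty p → Set p
HoldsOnCompleteFrom n₀ P = ∀ n → + n ℤ.≥ n₀ → holds P (K n)

record 𝒢 {n : ℕ} (r : ℕ) .{{_ : NonZero r}} (ℓ : ℤ) (G : Graph n) : Set where
  field
    cliqueFree : CliqueFree (suc r) G
    apex       : Fin n
    apex-deg   : + deg G apex ≡ ℓ ℤ.+ + 1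
    rest       : G ─ apex ≅ turán r (pred n)

fromℤ : ℤ → ℚᵘ
fromℤ i = i ℚ./ 1

-- The NonZero arguments below are denominators, positive in the range of r
-- of the case in which they occur.
record LargeEnough (ℓ : ℤ) (r n : ℕ) : Set where
  field
    r≡3   : r ≡ 3 → + n ℤ.≥ + 6 ℤ.* ℓ ℤ.+ + 26
    4≤r≤7 : .{{_ : NonZero (r ℕ.∸ 3)}} .{{_ : NonZero (2 ℕ.* r ℕ.∸ 2)}} →
            4 ℕ.≤ r → r ℕ.≤ 7 →
            fromℤ (+ n) ℚ.≥
              (fromℤ (+ 3 ℤ.+ ℓ) ℚ.+ (+ 4 ℤ.* (ℓ ℤ.+ + 2)) ℚ./ (r ℕ.∸ 3))
              ℚ.⊔
              (fromℤ (+ 5 ℤ.+ ℓ) ℚ.+ (+ r ℤ.+ + 2 ℤ.* ℓ ℤ.+ + 7) ℚ./ (2 ℕ.* r ℕ.∸ 2))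
    8≤r   : .{{_ : NonZero (r ℕ.∸ 4)}} →
            8 ℕ.≤ r →
            fromℤ (+ n) ℚ.≥
              fromℤ (ℓ ℤ.+ + 5) ℚ.+ (+ 4 ℤ.* (ℓ ℤ.+ + 4)) ℚ./ (r ℕ.∸ 4)

record Exceptional (ℓ : ℤ) (r n : ℕ) : Set where
  field
    r≡4        : r ≡ 4 → + n ℤ.> + 13 ℤ.- ℓ
    ℓ≡-1∧5≤r≤7 : ℓ ≡ -1ℤ → 5 ℕ.≤ r → r ℕ.≤ 7 → n ℕ.> 5
    ℓ≥0∧r≡5    : ℓ ℤ.≥ 0ℤ → r ≡ 5 →
                 + n ℤ.> (+ 17 ℤ.- ℓ) ℤ.⊓ (+ 10 ℤ.* ℓ ℤ.+ + 10)
    ℓ≥0∧6≤r≤7  : ℓ ℤ.≥ 0ℤ → 6 ℕ.≤ r → r ℕ.≤ 7 →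
                 + n ℤ.> (+ 4 ℤ.* + r ℤ.- + 3 ℤ.- ℓ) ℤ.⊓ (+ 6 ℤ.* ℓ ℤ.+ + 6)

turánBound : (r n : ℕ) → .{{_ : NonZero r}} → ℤ → ℤ
turánBound r n ℓ = + e (turán r (pred n)) ℤ.+ (ℓ ℤ.+ + 1)

{-# OPTIONS --safe #-}

-- Put L = ℓ + 1 and let t m be the number of edges of T_r(m).  Adding edges
-- between nonadjacent vertices of degree sum at least n + ℓ for as long as
-- possible leaves, by stability, a graph H ⊇ G without P, hence not complete.
-- If u, v are nonadjacent in H with maximal degree sum and k = deg u ≤ deg v,
-- the non-neighbours of v all have degree at most k in H.  So G has at least
-- one and at least j = k + 1 - L vertices of degree at most k, and
-- 2k + 2 ≤ n + L.
-- Deleting i ≤ j of them and applying Turán's theorem to the rest gives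
-- e(G) ≤ i k + t (n - i).  For k ≤ L take i = 1: this is the claimed bound,
-- with equality only if G ∈ 𝒢.  For k > L the bound is strict: if a constant c
-- satisfies c k + t (n - c) < L + t (n - 1) for the largest possible k, then
-- i = c handles every j ≥ c, and for 2 ≤ j ≤ c one takes i = j, because
-- j (j + L - 1) + t (n - j) is convex in j and maximal at j = 1 or j = c.
-- Under the hypotheses on n, c = 7, 6, 5, 4, 4 works for r = 3, …, 7 except
-- for small n, where a suitable c is found by exhaustion; for r ≥ 8, c = 3
-- works unless n = L + 5, and then c = 2 does.
module Submission where

open import Defs
open import Data.Nat.Properties using (+-0-commutativeMonoid)
open import Algebra.Properties.CommutativeMonoid.Sum +-0-commutativeMonoid
  using (sum; sum-cong-≗; ∑-distrib-+; ∑-comm; sum-permute; sum-remove)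
open import Data.Bool.Base using (Bool; true; false; T; not; _∧_)
open import Data.Bool.Properties as Bool using (∧-identityʳ; ∧-zeroʳ; not-injective; ¬-not)
open import Data.Empty using (⊥-elim)
open import Data.Fin.Base using (Fin; zero; suc; toℕ; punchIn; punchOut; fromℕ; fromℕ<)
open import Data.Fin.Permutation as Perm
  using (Permutation; Permutation′; permutation; _⟨$⟩ʳ_; _⟨$⟩ˡ_; _∘ₚ_; insert; insert-punchIn; inverseʳ; inverseˡ; flip)
open import Data.Fin.Permutation.Components using (transpose; transpose-inverse)
open import Data.Fin.Properties
  using (_≟_; any?; toℕ-injective; toℕ-fromℕ; toℕ-fromℕ<; toℕ<n; punchIn-injective; punchInᵢ≢i; punchIn-punchOut; ¬∀⟶∃¬; pigeonhole)
open import Data.Fin.Subset using (∣_∣)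
open import Data.Integer.Base as ℤ using (ℤ; +_; -1ℤ; -[1+_])
import Data.Integer.Properties as ℤ
import Data.Integer.Tactic.RingSolver as ℤ-Solver
open import Data.Nat.Base as ℕ using (ℕ; zero; suc; _+_; _*_; _∸_; _≤_; _<_; z≤n; s≤s; NonZero)
open import Data.Nat.DivMod
open import Data.Nat.Divisibility using (divides-refl)
open import Data.Nat.Induction using (<-wellFounded)
open import Data.Nat.Properties as ℕ
  using (≤-refl; ≤-trans; ≤-reflexive; +-comm; +-assoc; +-mono-≤; +-mono-<-≤; +-mono-≤-<; +-cancelˡ-≡; module ≤-Reasoning)
open import Data.Nat.Tactic.RingSolver using (solve-∀)
open import Data.Product.Base using (_×_; ∃; ∃-syntax; _,_; proj₁; proj₂)
open import Data.Rational.Unnormalised.Base as ℚ using (*≤*)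
import Data.Rational.Unnormalised.Properties as ℚ
open import Data.Sum.Base using (_⊎_; inj₁; inj₂; map)
open import Data.Vec.Base using (tabulate)
open import Function.Base using (_∘_)
open import Function.Bundles using (mk⇔)
open import Induction.WellFounded using (Acc; acc)
open import Level using (Level)
open import Relation.Binary.PropositionalEquality
open import Relation.Nullary.Decidable
  using (yes; no; Dec; does; dec-true; dec-false; does-⇔; from-yes; ¬?; _×-dec_; _⊎-dec_; _→-dec_)
open import Relation.Nullary.Negation using (¬_)

-- Counting and vertex deletion

𝟙 : Bool → ℕ
𝟙 true  = 1
𝟙 false = 0

count : ∀ {n} → (Fin n → Bool) → ℕ
count p = sum (𝟙 ∘ p)

∣tabulate∣≡count : ∀ {n} (p : Fin n → Bool) → ∣ tabulate p ∣ ≡ count p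
∣tabulate∣≡count {zero}  p = refl
∣tabulate∣≡count {suc n} p with p zero
... | true  = cong suc (∣tabulate∣≡count (p ∘ suc))
... | false = ∣tabulate∣≡count (p ∘ suc)

sum-mono-≤ : ∀ {n} {f g : Fin n → ℕ} → (∀ i → f i ≤ g i) → sum f ≤ sum g
sum-mono-≤ {zero}  f≤g = z≤n
sum-mono-≤ {suc n} f≤g = +-mono-≤ (f≤g zero) (sum-mono-≤ (f≤g ∘ suc))

sum-mono-< : ∀ {n} {f g : Fin n → ℕ} → (∀ i → f i ≤ g i) → ∀ i → f i < g i → sum f < sum g
sum-mono-< f≤g zero    fi<gi = +-mono-<-≤ fi<gi (sum-mono-≤ (f≤g ∘ suc))
sum-mono-< f≤g (suc i) fi<gi = +-mono-≤-< (f≤g zero) (sum-mono-< (f≤g ∘ suc) i fi<gi)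

sum-const : ∀ n {c} → sum {n} (λ _ → c) ≡ n * c
sum-const zero    = refl
sum-const (suc n) = cong (ℕ._+_ _) (sum-const n)

-- Pigeonhole principle that extends a clique: if fewer than n exclusions are spread over n
-- vertices, some vertex is excluded by nobody.
sum<n⇒zero : ∀ {n} (f : Fin n → ℕ) → sum f < n → ∃[ i ] f i ≡ 0
sum<n⇒zero {suc n} f sum<n with f zero in f₀
... | zero  = zero , f₀
... | suc a =
  let (i , fi≡0) = sum<n⇒zero (f ∘ suc) (ℕ.≤-<-trans (ℕ.m≤n+m _ a) (ℕ.s<s⁻¹ sum<n))
  in suc i , fi≡0

sum≡0⇒zero : ∀ {n} (f : Fin n → ℕ) → sum f ≡ 0 → ∀ i → f i ≡ 0
sum≡0⇒zero f eq zero    = ℕ.m+n≡0⇒m≡0 (f zero) eq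
sum≡0⇒zero f eq (suc i) = sum≡0⇒zero (f ∘ suc) (ℕ.m+n≡0⇒n≡0 (f zero) eq) i

sum-last : ∀ (f : ℕ → ℕ) m → sum {suc m} (f ∘ toℕ) ≡ sum {m} (f ∘ toℕ) + f m
sum-last f zero    = ℕ.+-identityʳ (f 0)
sum-last f (suc m) = trans (cong (ℕ._+_ (f 0)) (sum-last (f ∘ suc) m)) (sym (+-assoc (f 0) _ _))

𝟙-mono : ∀ {a b} → (a ≡ true → b ≡ true) → 𝟙 a ≤ 𝟙 b
𝟙-mono {false}     _   = z≤n
𝟙-mono {true}  {b} a⇒b rewrite a⇒b refl = ≤-refl

𝟙≡0⇒false : ∀ {a} → 𝟙 a ≡ 0 → a ≡ false
𝟙≡0⇒false {false} _ = refl

count-mono-≤ : ∀ {n} {p q : Fin n → Bool} → (∀ i → p i ≡ true → q i ≡ true) → count p ≤ count q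
count-mono-≤ p⇒q = sum-mono-≤ (λ i → 𝟙-mono (p⇒q i))

count-mono-< : ∀ {n} {p q : Fin n → Bool} → (∀ i → p i ≡ true → q i ≡ true) →
               ∀ i → p i ≡ false → q i ≡ true → count p < count q
count-mono-< p⇒q i pi qi =
  sum-mono-< (λ j → 𝟙-mono (p⇒q j)) i (subst₂ (λ a b → 𝟙 a < 𝟙 b) (sym pi) (sym qi) ≤-refl)

count-not : ∀ {n} (p : Fin n → Bool) → count p + count (not ∘ p) ≡ n
count-not {n} p = begin
  count p + count (not ∘ p)               ≡⟨ ∑-distrib-+ (𝟙 ∘ p) (𝟙 ∘ not ∘ p) ⟨
  sum (λ i → 𝟙 (p i) + 𝟙 (not (p i)))     ≡⟨ sum-cong-≗ (λ i → 𝟙-not (p i)) ⟩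
  sum (λ (i : Fin n) → 1)                 ≡⟨ sum-const n ⟩
  n * 1                                   ≡⟨ ℕ.*-identityʳ n ⟩
  n                                       ∎
  where
  open ≡-Reasoning
  𝟙-not : ∀ a → 𝟙 a + 𝟙 (not a) ≡ 1
  𝟙-not true  = refl
  𝟙-not false = refl

count≤n : ∀ {n} (p : Fin n → Bool) → count p ≤ n
count≤n p = ≤-trans (ℕ.m≤m+n _ _) (≤-reflexive (count-not p))

deg≡count : ∀ {n} (G : Graph n) u → deg G u ≡ count (adj G u)
deg≡count G u = ∣tabulate∣≡count (adj G u)

<ᵇ-total : ∀ {n} {u v : Fin n} → u ≢ v → 𝟙 (toℕ u ℕ.<ᵇ toℕ v) + 𝟙 (toℕ v ℕ.<ᵇ toℕ u) ≡ 1
<ᵇ-total {u = zero}  {zero}  u≢v = ⊥-elim (u≢v refl)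
<ᵇ-total {u = zero}  {suc v} u≢v = refl
<ᵇ-total {u = suc u} {zero}  u≢v = refl
<ᵇ-total {u = suc u} {suc v} u≢v = <ᵇ-total (u≢v ∘ cong suc)

Adj⇒≢ : ∀ {n} (G : Graph n) {u v} → adj G u v ≡ true → u ≢ v
Adj⇒≢ G {u} uv refl with () ← trans (sym uv) (adj-irrefl G u)

-- The matrix of edges with smaller endpoint first and its transpose add up to the adjacency matrix,
-- by `<ᵇ-total` off the diagonal.
handshake : ∀ {n} (G : Graph n) → e G + e G ≡ sum (deg G)
handshake G = begin
  e G + e G
    ≡⟨ cong₂ _+_ e≡ (trans e≡ (∑-comm (λ u v → 𝟙 (half u v)))) ⟩
  sum (λ u → sum λ v → 𝟙 (half u v)) + sum (λ u → sum λ v → 𝟙 (half v u))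
    ≡⟨ ∑-distrib-+ (λ u → sum λ v → 𝟙 (half u v)) (λ u → sum λ v → 𝟙 (half v u)) ⟨
  sum (λ u → sum (λ v → 𝟙 (half u v)) + sum (λ v → 𝟙 (half v u)))
    ≡⟨ sum-cong-≗ (λ u → sym (∑-distrib-+ (λ v → 𝟙 (half u v)) (λ v → 𝟙 (half v u)))) ⟩
  sum (λ u → sum (λ v → 𝟙 (half u v) + 𝟙 (half v u)))
    ≡⟨ sum-cong-≗ (λ u → sum-cong-≗ (halves u)) ⟩
  sum (λ u → count (adj G u))
    ≡⟨ sum-cong-≗ (λ u → sym (deg≡count G u)) ⟩
  sum (deg G) ∎
  where
  open ≡-Reasoning
  half : Fin _ → Fin _ → Bool
  half u v = (toℕ u ℕ.<ᵇ toℕ v) ∧ adj G u v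

  e≡ : e G ≡ sum (λ u → sum λ v → 𝟙 (half u v))
  e≡ = sum-cong-≗ (λ u → ∣tabulate∣≡count (half u))

  halves : ∀ u v → 𝟙 (half u v) + 𝟙 (half v u) ≡ 𝟙 (adj G u v)
  halves u v rewrite adj-sym G v u with adj G u v in uv
  ... | true  rewrite ∧-identityʳ (toℕ u ℕ.<ᵇ toℕ v) | ∧-identityʳ (toℕ v ℕ.<ᵇ toℕ u) = <ᵇ-total (Adj⇒≢ G uv)
  ... | false rewrite ∧-zeroʳ (toℕ u ℕ.<ᵇ toℕ v) | ∧-zeroʳ (toℕ v ℕ.<ᵇ toℕ u) = refl

double-injective : ∀ {a b} → a + a ≡ b + b → a ≡ b
double-injective {a} {b} eq = ℕ.*-cancelˡ-≡ a b 2
  (trans (cong (ℕ._+_ a) (ℕ.+-identityʳ a)) (trans eq (sym (cong (ℕ._+_ b) (ℕ.+-identityʳ b)))))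

≅-pointwise : ∀ {n} {G H : Graph n} → (∀ u v → adj G u v ≡ adj H u v) → G ≅ H
≅-pointwise eq = Perm.id , eq

deg-≅ : ∀ {n} {G H : Graph n} ((π , _) : G ≅ H) u → deg G u ≡ deg H (π ⟨$⟩ʳ u)
deg-≅ {G = G} {H} (π , eq) u = begin
  deg G u                               ≡⟨ deg≡count G u ⟩
  count (adj G u)                       ≡⟨ sum-cong-≗ (λ v → cong 𝟙 (eq u v)) ⟩
  count (adj H (π ⟨$⟩ʳ u) ∘ (π ⟨$⟩ʳ_))  ≡⟨ sum-permute (𝟙 ∘ adj H (π ⟨$⟩ʳ u)) π ⟨
  count (adj H (π ⟨$⟩ʳ u))              ≡⟨ deg≡count H _ ⟨
  deg H (π ⟨$⟩ʳ u)                      ∎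
  where open ≡-Reasoning

e-≅ : ∀ {n} {G H : Graph n} → G ≅ H → e G ≡ e H
e-≅ {G = G} {H} G≅H@(π , _) = double-injective (begin
  e G + e G                     ≡⟨ handshake G ⟩
  sum (deg G)                   ≡⟨ sum-cong-≗ (deg-≅ {G = G} {H} G≅H) ⟩
  sum (deg H ∘ (π ⟨$⟩ʳ_))       ≡⟨ sum-permute (deg H) π ⟨
  sum (deg H)                   ≡⟨ handshake H ⟨
  e H + e H                     ∎)
  where open ≡-Reasoning

deg-─ : ∀ {n} (G : Graph (suc n)) v u →
        deg G (punchIn v u) ≡ 𝟙 (adj G v (punchIn v u)) + deg (G ─ v) u
deg-─ G v u = begin
  deg G (punchIn v u)                                         ≡⟨ deg≡count G _ ⟩
  count (adj G (punchIn v u))                                 ≡⟨ sum-remove {i = v} (𝟙 ∘ adj G (punchIn v u)) ⟩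
  𝟙 (adj G (punchIn v u) v) + count (adj (G ─ v) u)           ≡⟨ cong₂ _+_ (cong 𝟙 (adj-sym G _ v)) (sym (deg≡count (G ─ v) u)) ⟩
  𝟙 (adj G v (punchIn v u)) + deg (G ─ v) u                   ∎
  where open ≡-Reasoning

deg-punchIn : ∀ {n} (G : Graph (suc n)) v → deg G v ≡ count (adj G v ∘ punchIn v)
deg-punchIn G v = begin
  deg G v                                           ≡⟨ deg≡count G v ⟩
  count (adj G v)                                   ≡⟨ sum-remove {i = v} (𝟙 ∘ adj G v) ⟩
  𝟙 (adj G v v) + count (adj G v ∘ punchIn v)       ≡⟨ cong (λ a → 𝟙 a + count (adj G v ∘ punchIn v)) (adj-irrefl G v) ⟩
  count (adj G v ∘ punchIn v)                       ∎
  where open ≡-Reasoning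

-- Doubling both sides avoids tracking the order of endpoints through `punchIn`: in the degree sum
-- `v` contributes its degree once itself and once through its neighbours.
e-─ : ∀ {n} (G : Graph (suc n)) v → e G ≡ deg G v + e (G ─ v)
e-─ G v = double-injective (begin
  e G + e G
    ≡⟨ handshake G ⟩
  sum (deg G)
    ≡⟨ sum-remove {i = v} (deg G) ⟩
  deg G v + sum (deg G ∘ punchIn v)
    ≡⟨ cong (ℕ._+_ (deg G v)) (sum-cong-≗ (deg-─ G v)) ⟩
  deg G v + sum (λ u → 𝟙 (adj G v (punchIn v u)) + deg (G ─ v) u)
    ≡⟨ cong (ℕ._+_ (deg G v)) (∑-distrib-+ (𝟙 ∘ adj G v ∘ punchIn v) (deg (G ─ v))) ⟩
  deg G v + (count (adj G v ∘ punchIn v) + sum (deg (G ─ v)))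
    ≡⟨ cong (ℕ._+_ (deg G v)) (cong₂ _+_ (sym (deg-punchIn G v)) (sym (handshake (G ─ v)))) ⟩
  deg G v + (deg G v + (e (G ─ v) + e (G ─ v)))
    ≡⟨ rearrange (deg G v) (e (G ─ v)) ⟩
  (deg G v + e (G ─ v)) + (deg G v + e (G ─ v)) ∎)
  where
  open ≡-Reasoning
  rearrange : ∀ a b → a + (a + (b + b)) ≡ (a + b) + (a + b)
  rearrange = solve-∀

≡true⇒T : ∀ {a} → a ≡ true → T a
≡true⇒T refl = _

T⇒≡true : ∀ {a} → T a → a ≡ true
T⇒≡true {true} _ = refl

clique : ∀ {k n} (G : Graph n) (f : Fin k → Fin n) →
         (∀ i j → i ≢ j → adj G (f i) (f j) ≡ true) → K k ⊑ G
clique G f adjacent = f , injective , λ i j ij → ≡true⇒T (adjacent i j (K⇒≢ i j ij))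
  where
  injective : ∀ {i j} → f i ≡ f j → i ≡ j
  injective {i} {j} fi≡fj with i ≟ j
  ... | yes i≡j = i≡j
  ... | no  i≢j = ⊥-elim (Adj⇒≢ G (adjacent i j i≢j) fi≡fj)

  K⇒≢ : ∀ {k} (i j : Fin k) → T (not (does (i ≟ j))) → i ≢ j
  K⇒≢ i j ij with i ≟ j
  ... | no i≢j = i≢j

cliqueFree-─ : ∀ {k n} {G : Graph (suc n)} v → CliqueFree k G → CliqueFree k (G ─ v)
cliqueFree-─ v free (f , f-inj , f-hom) =
  free (punchIn v ∘ f , (λ eq → f-inj (punchIn-injective v _ _ eq)) , f-hom)

-- Turán numbers and residue classes

-- The increment is the degree of vertex `m` towards 0, ..., m-1: it misses only the ⌊m/r⌋ earlier
-- members of its own residue class.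
turánSize : (r : ℕ) .{{_ : NonZero r}} → ℕ → ℕ
turánSize r zero    = 0
turánSize r (suc m) = turánSize r m + (m ∸ m / r)

toℕ-mod : ∀ m r .{{_ : NonZero r}} → toℕ (m mod r) ≡ m % r
toℕ-mod m r = toℕ-fromℕ< (m%n<n m r)

[a+qr]%r≡a : ∀ {a} q r .{{_ : NonZero r}} → a < r → (a + q * r) % r ≡ a
[a+qr]%r≡a {a} q r a<r = trans ([m+kn]%n≡m%n a q r) (m<n⇒m%n≡m a<r)

[a+qr]/r≡q : ∀ {a} q r .{{_ : NonZero r}} → a < r → (a + q * r) / r ≡ q
[a+qr]/r≡q {a} q r a<r = begin
  (a + q * r) / r       ≡⟨ +-distrib-/-∣ʳ a (divides-refl q) ⟩
  a / r + q * r / r     ≡⟨ cong₂ _+_ (m<n⇒m/n≡0 a<r) (m*n/n≡m q r) ⟩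
  q                     ∎
  where open ≡-Reasoning

classSize : ∀ {r} .{{_ : NonZero r}} → Fin r → ℕ → ℕ
classSize {r} i m = count {m} (λ y → does (toℕ y mod r ≟ i))

𝟙-<ᵇ-suc : ∀ x s → 𝟙 (x ℕ.<ᵇ suc s) ≡ 𝟙 (x ℕ.<ᵇ s) + 𝟙 (s ℕ.≡ᵇ x)
𝟙-<ᵇ-suc zero    zero    = refl
𝟙-<ᵇ-suc zero    (suc s) = refl
𝟙-<ᵇ-suc (suc x) zero    = refl
𝟙-<ᵇ-suc (suc x) (suc s) = 𝟙-<ᵇ-suc x s

<⇒<ᵇ≡true : ∀ {a b} → a < b → (a ℕ.<ᵇ b) ≡ true
<⇒<ᵇ≡true a<b = T⇒≡true (ℕ.<⇒<ᵇ a<b)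

classSize≡ : ∀ {r} .{{_ : NonZero r}} (i : Fin r) m → classSize i m ≡ m / r + 𝟙 (toℕ i ℕ.<ᵇ m % r)
classSize≡ {r} i zero = sym (cong₂ (λ q s → q + 𝟙 (toℕ i ℕ.<ᵇ s)) (0/n≡0 r) (m*n%n≡0 0 r))
classSize≡ {r} i (suc m) = begin
  classSize i (suc m)
    ≡⟨ sum-last (λ y → 𝟙 (does (y mod r ≟ i))) m ⟩
  classSize i m + 𝟙 (does (m mod r ≟ i))
    ≡⟨ cong₂ _+_ (classSize≡ i m) (cong 𝟙 (does-⇔ (mk⇔ to from) (m mod r ≟ i) (m % r ℕ.≟ toℕ i))) ⟩
  m / r + 𝟙 (toℕ i ℕ.<ᵇ m % r) + 𝟙 (m % r ℕ.≡ᵇ toℕ i)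
    ≡⟨ +-assoc (m / r) _ _ ⟩
  m / r + (𝟙 (toℕ i ℕ.<ᵇ m % r) + 𝟙 (m % r ℕ.≡ᵇ toℕ i))
    ≡⟨ cong (ℕ._+_ (m / r)) (𝟙-<ᵇ-suc (toℕ i) (m % r)) ⟨
  m / r + 𝟙 (toℕ i ℕ.<ᵇ suc (m % r))
    ≡⟨ carry ⟩
  suc m / r + 𝟙 (toℕ i ℕ.<ᵇ suc m % r) ∎
  where
  open ≡-Reasoning
  to : m mod r ≡ i → m % r ≡ toℕ i
  to refl = sym (toℕ-mod m r)

  from : m % r ≡ toℕ i → m mod r ≡ i
  from eq = toℕ-injective (trans (toℕ-mod m r) eq)

  carry : m / r + 𝟙 (toℕ i ℕ.<ᵇ suc (m % r)) ≡ suc m / r + 𝟙 (toℕ i ℕ.<ᵇ suc m % r)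
  -- Either the last block stays incomplete, or it fills up: then every residue has gained one
  -- element, and the quotient grows while the remainder returns to 0.
  carry with ℕ.m≤n⇒m<n∨m≡n (m%n<n m r)
  ... | inj₁ 1+s<r = cong₂ (λ q s → q + 𝟙 (toℕ i ℕ.<ᵇ s))
    (sym (trans (cong (_/ r) 1+m≡) ([a+qr]/r≡q (m / r) r 1+s<r)))
    (sym (trans (cong (_% r) 1+m≡) ([a+qr]%r≡a (m / r) r 1+s<r)))
    where
    1+m≡ : suc m ≡ suc (m % r) + m / r * r
    1+m≡ = cong suc (m≡m%n+[m/n]*n m r)
  ... | inj₂ 1+s≡r = begin
    m / r + 𝟙 (toℕ i ℕ.<ᵇ suc (m % r))
      ≡⟨ cong (λ b → m / r + 𝟙 b) (<⇒<ᵇ≡true (subst (toℕ i <_) (sym 1+s≡r) (toℕ<n i))) ⟩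
    m / r + 1
      ≡⟨ trans (+-comm (m / r) 1) (sym (ℕ.+-identityʳ (suc (m / r)))) ⟩
    suc (m / r) + 0
      ≡⟨ cong₂ (λ q s → q + 𝟙 (toℕ i ℕ.<ᵇ s))
           (trans (cong (_/ r) 1+m≡) ([a+qr]/r≡q (suc (m / r)) r 0<r))
           (trans (cong (_% r) 1+m≡) ([a+qr]%r≡a (suc (m / r)) r 0<r)) ⟨
    suc m / r + 𝟙 (toℕ i ℕ.<ᵇ suc m % r) ∎
    where
    1+m≡ : suc m ≡ 0 + suc (m / r) * r
    1+m≡ = trans (cong suc (m≡m%n+[m/n]*n m r)) (cong (_+ m / r * r) 1+s≡r)
    0<r : 0 < r
    0<r = ℕ.≤-<-trans z≤n (m%n<n m r)

toℕ-punchIn-fromℕ : ∀ {m} (y : Fin m) → toℕ (punchIn (fromℕ m) y) ≡ toℕ y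
toℕ-punchIn-fromℕ zero    = refl
toℕ-punchIn-fromℕ (suc y) = cong suc (toℕ-punchIn-fromℕ y)

n<ᵇn≡false : ∀ n → (n ℕ.<ᵇ n) ≡ false
n<ᵇn≡false zero    = refl
n<ᵇn≡false (suc n) = n<ᵇn≡false n

-- Taking residue classes as parts makes every initial segment a Turán graph with the same labels,
-- so the identity permutation suffices.
turán-─-last : ∀ r m .{{_ : NonZero r}} → turán r (suc m) ─ fromℕ m ≅ turán r m
turán-─-last r m = ≅-pointwise {G = turán r (suc m) ─ fromℕ m} {turán r m} λ x y →
  cong₂ (λ a b → not (does (a mod r ≟ b mod r))) (toℕ-punchIn-fromℕ x) (toℕ-punchIn-fromℕ y)

deg-turán-last : ∀ r m .{{_ : NonZero r}} → deg (turán r (suc m)) (fromℕ m) ≡ m ∸ m / r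
deg-turán-last r m = begin
  deg (turán r (suc m)) (fromℕ m)
    ≡⟨ deg-punchIn (turán r (suc m)) (fromℕ m) ⟩
  count (adj (turán r (suc m)) (fromℕ m) ∘ punchIn (fromℕ m))
    ≡⟨ sum-cong-≗ {m} (λ y → cong (𝟙 ∘ not) (trans
         (cong₂ (λ a b → does (a mod r ≟ b mod r)) (toℕ-fromℕ m) (toℕ-punchIn-fromℕ {m} y))
         (does-⇔ (mk⇔ sym sym) (m mod r ≟ toℕ y mod r) (toℕ y mod r ≟ m mod r)))) ⟩
  count (not ∘ inClass)
    ≡⟨ ℕ.m+n∸m≡n (count inClass) _ ⟨
  count inClass + count (not ∘ inClass) ∸ count inClass
    ≡⟨ cong₂ _∸_ (count-not inClass) inClass≡ ⟩
  m ∸ m / r ∎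
  where
  open ≡-Reasoning
  inClass : Fin m → Bool
  inClass y = does (toℕ y mod r ≟ m mod r)

  inClass≡ : count inClass ≡ m / r
  inClass≡ = trans (classSize≡ (m mod r) m)
    (trans (cong (λ b → m / r + 𝟙 b) (trans (cong (ℕ._<ᵇ m % r) (toℕ-mod m r)) (n<ᵇn≡false (m % r))))
           (ℕ.+-identityʳ (m / r)))

e-turán : ∀ r m .{{_ : NonZero r}} → e (turán r m) ≡ turánSize r m
e-turán r zero    = refl
e-turán r (suc m) = begin
  e (turán r (suc m))
    ≡⟨ e-─ (turán r (suc m)) (fromℕ m) ⟩
  deg (turán r (suc m)) (fromℕ m) + e (turán r (suc m) ─ fromℕ m)
    ≡⟨ cong₂ _+_ (deg-turán-last r m) (trans (e-≅ {G = turán r (suc m) ─ fromℕ m} {turán r m} (turán-─-last r m)) (e-turán r m)) ⟩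
  m ∸ m / r + turánSize r m
    ≡⟨ +-comm (m ∸ m / r) _ ⟩
  turánSize r (suc m) ∎
  where open ≡-Reasoning

-- Each vertex has at most `q` non-neighbours, itself included. At most `r` chosen vertices
-- therefore exclude at most r q < n vertices, and any vertex left over is distinct from and
-- adjacent to all of them.
greedyClique : ∀ {n} (G : Graph n) q r → (∀ v → n ≤ deg G v + q) → r * q < n → K (suc r) ⊑ G
greedyClique {n} G q r n≤deg+q rq<n = let (f , adjacent) = build (suc r) ≤-refl in clique G f adjacent
  where
  nonNeighbours : ∀ v → count (not ∘ adj G v) ≤ q
  nonNeighbours v = ℕ.+-cancelˡ-≤ (count (adj G v)) _ _
    (subst₂ _≤_ (sym (count-not (adj G v))) (cong (_+ q) (deg≡count G v)) (n≤deg+q v))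

  build : ∀ k → k ≤ suc r → ∃[ f ] (∀ (i j : Fin k) → i ≢ j → adj G (f i) (f j) ≡ true)
  build zero    _         = (λ ()) , λ ()
  build (suc k) (s≤s k≤r) = f′ , adjacent′
    where
    f = proj₁ (build k (ℕ.m≤n⇒m≤1+n k≤r))
    adjacent = proj₂ (build k (ℕ.m≤n⇒m≤1+n k≤r))

    missed : Fin n → ℕ
    missed w = sum (λ i → 𝟙 (not (adj G (f i) w)))

    few : sum missed < n
    few = begin-strict
      sum missed                              ≡⟨ ∑-comm (λ w i → 𝟙 (not (adj G (f i) w))) ⟩
      sum (λ i → count (not ∘ adj G (f i)))   ≤⟨ sum-mono-≤ (nonNeighbours ∘ f) ⟩
      sum {k} (λ _ → q)                       ≡⟨ sum-const k ⟩
      k * q                                   ≤⟨ ℕ.*-monoˡ-≤ q k≤r ⟩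
      r * q                                   <⟨ rq<n ⟩
      n                                       ∎
      where open ≤-Reasoning

    w = proj₁ (sum<n⇒zero missed few)

    adjacent-w : ∀ i → adj G (f i) w ≡ true
    adjacent-w i = not-injective (𝟙≡0⇒false (sum≡0⇒zero (λ i → 𝟙 (not (adj G (f i) w))) (proj₂ (sum<n⇒zero missed few)) i))

    f′ : Fin (suc k) → Fin n
    f′ zero    = w
    f′ (suc i) = f i

    adjacent′ : ∀ i j → i ≢ j → adj G (f′ i) (f′ j) ≡ true
    adjacent′ zero    zero    i≢j = ⊥-elim (i≢j refl)
    adjacent′ zero    (suc j) i≢j = trans (adj-sym G w (f j)) (adjacent-w j)
    adjacent′ (suc i) zero    i≢j = adjacent-w i
    adjacent′ (suc i) (suc j) i≢j = adjacent i j (i≢j ∘ cong suc)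

-- Exchanging residue classes, and Turán's theorem with its equality case

transpose-cases : ∀ {n} (i j k : Fin n) → (k ≡ i ⊎ k ≡ j) ⊎ transpose i j k ≡ k
transpose-cases i j k with k ≟ i
... | yes k≡i = inj₁ (inj₁ k≡i)
... | no  _ with k ≟ j
...   | yes k≡j = inj₁ (inj₂ k≡j)
...   | no  _   = inj₂ refl

transpose-self : ∀ {n} (i j : Fin n) → transpose i j i ≡ j
transpose-self i j rewrite dec-true (i ≟ i) refl = refl

transpose-injective : ∀ {n} (i j : Fin n) {k l} → transpose i j k ≡ transpose i j l → k ≡ l
transpose-injective i j eq =
  trans (sym (transpose-inverse j i)) (trans (cong (transpose j i) eq) (transpose-inverse j i))

-- Residue classes i and j that both miss the incomplete last block of
-- 0, …, m-1 have the same size and can be exchanged blockwise.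
module SwapClasses {r : ℕ} .{{_ : NonZero r}} (m : ℕ) where

  swapℕ : Fin r → Fin r → ℕ → ℕ
  swapℕ i j y = toℕ (transpose i j (y mod r)) + y / r * r

  swapℕ-mod : ∀ i j y → swapℕ i j y mod r ≡ transpose i j (y mod r)
  swapℕ-mod i j y = toℕ-injective (trans (toℕ-mod (swapℕ i j y) r) ([a+qr]%r≡a (y / r) r (toℕ<n _)))

  swapℕ-/ : ∀ i j y → swapℕ i j y / r ≡ y / r
  swapℕ-/ i j y = [a+qr]/r≡q (y / r) r (toℕ<n _)

  swapℕ-inverse : ∀ i j y → swapℕ i j (swapℕ j i y) ≡ y
  swapℕ-inverse i j y = begin
    swapℕ i j (swapℕ j i y)
      ≡⟨ cong₂ (λ a q → toℕ a + q * r)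
           (trans (cong (transpose i j) (swapℕ-mod j i y)) (transpose-inverse i j))
           (swapℕ-/ j i y) ⟩
    toℕ (y mod r) + y / r * r   ≡⟨ cong (_+ y / r * r) (toℕ-mod y r) ⟩
    y % r + y / r * r           ≡⟨ m≡m%n+[m/n]*n y r ⟨
    y                           ∎
    where open ≡-Reasoning

  -- A number whose residue is neither `i` nor `j` stays fixed. Otherwise its residue is at least m
  -- % r, so it lies in a complete block, and the exchange does not leave that block.
  swapℕ-< : ∀ {i j} → m % r ≤ toℕ i → m % r ≤ toℕ j → ∀ {y} → y < m → swapℕ i j y < m
  swapℕ-< {i} {j} s≤i s≤j {y} y<m with transpose-cases i j (y mod r)
  ... | inj₂ fixed = subst (_< m) (sym (trans (cong (λ a → toℕ a + y / r * r) fixed)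
          (trans (cong (_+ y / r * r) (toℕ-mod y r)) (sym (m≡m%n+[m/n]*n y r))))) y<m
  ... | inj₁ i∨j = begin-strict
    swapℕ i j y             <⟨ ℕ.+-monoˡ-< (y / r * r) (toℕ<n (transpose i j (y mod r))) ⟩
    suc (y / r) * r         ≤⟨ ℕ.*-monoˡ-≤ r y/r<m/r ⟩
    m / r * r               ≤⟨ m/n*n≤m m r ⟩
    m                       ∎
    where
    open ≤-Reasoning
    large : y mod r ≡ i ⊎ y mod r ≡ j → m % r ≤ y % r
    large (inj₁ y≡i) = subst (m % r ≤_) (trans (cong toℕ (sym y≡i)) (toℕ-mod y r)) s≤i
    large (inj₂ y≡j) = subst (m % r ≤_) (trans (cong toℕ (sym y≡j)) (toℕ-mod y r)) s≤j

    y/r<m/r : y / r < m / r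
    y/r<m/r = ℕ.≰⇒> λ m/r≤y/r → ℕ.<⇒≱ y<m (subst₂ _≤_ (sym (m≡m%n+[m/n]*n m r)) (sym (m≡m%n+[m/n]*n y r))
      (+-mono-≤ (large i∨j) (ℕ.*-monoˡ-≤ r m/r≤y/r)))

  swapFin : ∀ {i j} → m % r ≤ toℕ i → m % r ≤ toℕ j → Fin m → Fin m
  swapFin s≤i s≤j y = fromℕ< (swapℕ-< s≤i s≤j (toℕ<n y))

  toℕ-swapFin : ∀ {i j} (s≤i : m % r ≤ toℕ i) (s≤j : m % r ≤ toℕ j) y →
                toℕ (swapFin s≤i s≤j y) ≡ swapℕ i j (toℕ y)
  toℕ-swapFin s≤i s≤j y = toℕ-fromℕ< (swapℕ-< s≤i s≤j (toℕ<n y))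

  swapFin-inverse : ∀ {i j} (s≤i : m % r ≤ toℕ i) (s≤j : m % r ≤ toℕ j) y →
                    swapFin s≤i s≤j (swapFin s≤j s≤i y) ≡ y
  swapFin-inverse {i} {j} s≤i s≤j y = toℕ-injective (begin
    toℕ (swapFin s≤i s≤j (swapFin s≤j s≤i y))   ≡⟨ toℕ-swapFin s≤i s≤j _ ⟩
    swapℕ i j (toℕ (swapFin s≤j s≤i y))         ≡⟨ cong (swapℕ i j) (toℕ-swapFin s≤j s≤i y) ⟩
    swapℕ i j (swapℕ j i (toℕ y))               ≡⟨ swapℕ-inverse i j (toℕ y) ⟩
    toℕ y                                       ∎)
    where open ≡-Reasoning

  swapClasses : ∀ {i j} → m % r ≤ toℕ i → m % r ≤ toℕ j → Permutation′ m
  swapClasses s≤i s≤j = permutation (swapFin s≤i s≤j) (swapFin s≤j s≤i)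
    (swapFin-inverse s≤i s≤j) (swapFin-inverse s≤j s≤i)

  swapClasses-mod : ∀ {i j} (s≤i : m % r ≤ toℕ i) (s≤j : m % r ≤ toℕ j) y →
    toℕ (swapClasses s≤i s≤j ⟨$⟩ʳ y) mod r ≡ transpose i j (toℕ y mod r)
  swapClasses-mod {i} {j} s≤i s≤j y =
    trans (cong (_mod r) (toℕ-swapFin s≤i s≤j y)) (swapℕ-mod i j (toℕ y))

does-true⇒ : ∀ {n} {i j : Fin n} → does (i ≟ j) ≡ true → i ≡ j
does-true⇒ {i = i} {j} eq with yes i≡j ← i ≟ j = i≡j

punchIn-cases : ∀ {n} (v u : Fin (suc n)) → u ≡ v ⊎ ∃[ x ] u ≡ punchIn v x
punchIn-cases v u with v ≟ u
... | yes v≡u = inj₁ (sym v≡u)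
... | no  v≢u = inj₂ (punchOut v≢u , sym (punchIn-punchOut v≢u))

insert-self : ∀ {m n} i j (π : Permutation m n) → insert i j π ⟨$⟩ʳ i ≡ j
insert-self i j π with i ≟ i
... | yes _   = refl
... | no  i≢i = ⊥-elim (i≢i refl)

-- If v met every class of G ─ v there would be a K_{r+1}, so v misses a
-- whole class; by its degree that class is a smallest one and v misses
-- nothing else, so v can be moved into it.
extend-turán : ∀ {r m} .{{_ : NonZero r}} (G : Graph (suc m)) v → CliqueFree (suc r) G →
               deg G v ≡ m ∸ m / r → G ─ v ≅ turán r m → G ≅ turán r (suc m)
extend-turán {r} {m} G v free deg-v (π , G-v≅) = ρ , adj≡
  where
  joined : Fin m → Bool
  joined y = adj G v (punchIn v (π ⟨$⟩ˡ y))

  G-v-adj : ∀ y z → adj (G ─ v) (π ⟨$⟩ˡ y) (π ⟨$⟩ˡ z) ≡ adj (turán r m) y z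
  G-v-adj y z = trans (G-v≅ _ _) (cong₂ (adj (turán r m)) (inverseʳ π) (inverseʳ π))

  meets? : ∀ i → Dec (∃[ y ] (toℕ {m} y mod r ≡ i × joined y ≡ true))
  meets? i = any? (λ y → (toℕ y mod r ≟ i) ×-dec (joined y Bool.≟ true))

  ¬meetsAll : ¬ (∀ i → ∃[ y ] (toℕ {m} y mod r ≡ i × joined y ≡ true))
  ¬meetsAll meet = free (clique G f adjacent)
    where
    rep : Fin r → Fin m
    rep i = proj₁ (meet i)

    f : Fin (suc r) → Fin (suc m)
    f zero    = v
    f (suc i) = punchIn v (π ⟨$⟩ˡ rep i)

    adjacent : ∀ i j → i ≢ j → adj G (f i) (f j) ≡ true
    adjacent zero    zero    i≢j = ⊥-elim (i≢j refl)
    adjacent zero    (suc j) i≢j = proj₂ (proj₂ (meet j))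
    adjacent (suc i) zero    i≢j = trans (adj-sym G _ v) (proj₂ (proj₂ (meet i)))
    adjacent (suc i) (suc j) i≢j = trans (G-v-adj (rep i) (rep j)) (cong not
      (dec-false (toℕ (rep i) mod r ≟ toℕ (rep j) mod r) λ eq → i≢j (cong suc
        (trans (sym (proj₁ (proj₂ (meet i)))) (trans eq (proj₁ (proj₂ (meet j))))))))

  missed : ∃[ i ] ¬ (∃[ y ] (toℕ {m} y mod r ≡ i × joined y ≡ true))
  missed = ¬∀⟶∃¬ r _ meets? ¬meetsAll

  i : Fin r
  i = proj₁ missed

  inClass : Fin m → Bool
  inClass y = does (toℕ y mod r ≟ i)

  inClass⇒¬joined : ∀ y → inClass y ≡ true → not (joined y) ≡ true
  inClass⇒¬joined y y∈i = cong not (¬-not λ vy → proj₂ missed (y , does-true⇒ y∈i , vy))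

  count-¬joined : count (not ∘ joined) ≡ m / r
  count-¬joined = begin
    count (not ∘ joined)                                  ≡⟨ ℕ.m+n∸m≡n (count joined) _ ⟨
    count joined + count (not ∘ joined) ∸ count joined    ≡⟨ cong₂ _∸_ (count-not joined) count-joined ⟩
    m ∸ (m ∸ m / r)                                       ≡⟨ ℕ.m∸[m∸n]≡n (m/n≤m m r) ⟩
    m / r                                                 ∎
    where
    open ≡-Reasoning
    count-joined : count joined ≡ m ∸ m / r
    count-joined = begin
      count joined                  ≡⟨ sum-permute (𝟙 ∘ adj G v ∘ punchIn v) (flip π) ⟨
      count (adj G v ∘ punchIn v)   ≡⟨ deg-punchIn G v ⟨
      deg G v                       ≡⟨ deg-v ⟩
      m ∸ m / r                     ∎

  -- A class of index below m % r has m / r + 1 members, too many to fit among the m / r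
  -- non-neighbours of `v`.
  s≤i : m % r ≤ toℕ i
  s≤i = ℕ.≮⇒≥ λ i<s → ℕ.<⇒≱ (ℕ.m<m+n (m / r) (s≤s z≤n)) (begin
    m / r + 1                           ≡⟨ cong (λ b → m / r + 𝟙 b) (<⇒<ᵇ≡true i<s) ⟨
    m / r + 𝟙 (toℕ i ℕ.<ᵇ m % r)        ≡⟨ classSize≡ i m ⟨
    count inClass                       ≤⟨ count-mono-≤ inClass⇒¬joined ⟩
    count (not ∘ joined)                ≡⟨ count-¬joined ⟩
    m / r                               ∎)
    where open ≤-Reasoning

  ¬joined⇒inClass : ∀ y → joined y ≡ false → inClass y ≡ true
  ¬joined⇒inClass y vy with inClass y in y∈i
  ... | true  = refl
  ... | false = ⊥-elim (ℕ.<-irrefl refl (begin-strict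
    m / r                               ≤⟨ ℕ.m≤m+n (m / r) _ ⟩
    m / r + 𝟙 (toℕ i ℕ.<ᵇ m % r)        ≡⟨ classSize≡ i m ⟨
    count inClass                       <⟨ count-mono-< inClass⇒¬joined y y∈i (cong not vy) ⟩
    count (not ∘ joined)                ≡⟨ count-¬joined ⟩
    m / r                               ∎))
    where open ≤-Reasoning

  joined≡ : ∀ y → joined y ≡ not (inClass y)
  joined≡ y with joined y in vy
  ... | false = sym (cong not (¬joined⇒inClass y vy))
  ... | true  with inClass y in y∈i
  ...   | false = refl
  ...   | true  with () ← trans (sym (cong not vy)) (inClass⇒¬joined y y∈i)

  open SwapClasses {r} m

  s≤s% : m % r ≤ toℕ (m mod r)
  s≤s% = ≤-reflexive (sym (toℕ-mod m r))

  -- The vertex `v` is to become the number `m`, so the class it misses must first be moved to the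
  -- residue of `m`.
  σ : Permutation′ m
  σ = swapClasses s≤i s≤s%

  ρ : Permutation′ (suc m)
  ρ = insert v (fromℕ m) (π ∘ₚ σ)

  τ : Fin r → Fin r
  τ = transpose i (m mod r)

  ρ-v : toℕ (ρ ⟨$⟩ʳ v) mod r ≡ m mod r
  ρ-v = cong (_mod r) (trans (cong toℕ (insert-self v (fromℕ m) (π ∘ₚ σ))) (toℕ-fromℕ m))

  ρ-punchIn : ∀ x → toℕ (ρ ⟨$⟩ʳ punchIn v x) mod r ≡ τ (toℕ (π ⟨$⟩ʳ x) mod r)
  ρ-punchIn x = begin
    toℕ (ρ ⟨$⟩ʳ punchIn v x) mod r
      ≡⟨ cong (λ z → toℕ z mod r) (insert-punchIn v (fromℕ m) (π ∘ₚ σ) x) ⟩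
    toℕ (punchIn (fromℕ m) (σ ⟨$⟩ʳ (π ⟨$⟩ʳ x))) mod r
      ≡⟨ cong (_mod r) (toℕ-punchIn-fromℕ (σ ⟨$⟩ʳ (π ⟨$⟩ʳ x))) ⟩
    toℕ (σ ⟨$⟩ʳ (π ⟨$⟩ʳ x)) mod r
      ≡⟨ swapClasses-mod s≤i s≤s% (π ⟨$⟩ʳ x) ⟩
    τ (toℕ (π ⟨$⟩ʳ x) mod r) ∎
    where open ≡-Reasoning

  adj-v : ∀ x → adj G v (punchIn v x) ≡ adj (turán r (suc m)) (ρ ⟨$⟩ʳ v) (ρ ⟨$⟩ʳ punchIn v x)
  adj-v x = begin
    adj G v (punchIn v x)
      ≡⟨ cong (adj G v ∘ punchIn v) (inverseˡ π) ⟨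
    joined (π ⟨$⟩ʳ x)
      ≡⟨ joined≡ (π ⟨$⟩ʳ x) ⟩
    not (does (toℕ (π ⟨$⟩ʳ x) mod r ≟ i))
      ≡⟨ cong not (does-⇔ (mk⇔ to from) (toℕ (π ⟨$⟩ʳ x) mod r ≟ i) (m mod r ≟ τ (toℕ (π ⟨$⟩ʳ x) mod r))) ⟩
    not (does (m mod r ≟ τ (toℕ (π ⟨$⟩ʳ x) mod r)))
      ≡⟨ cong₂ (λ a b → not (does (a ≟ b))) ρ-v (ρ-punchIn x) ⟨
    adj (turán r (suc m)) (ρ ⟨$⟩ʳ v) (ρ ⟨$⟩ʳ punchIn v x) ∎
    where
    open ≡-Reasoning
    to : toℕ (π ⟨$⟩ʳ x) mod r ≡ i → m mod r ≡ τ (toℕ (π ⟨$⟩ʳ x) mod r)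
    to eq = sym (trans (cong τ eq) (transpose-self i (m mod r)))

    from : m mod r ≡ τ (toℕ (π ⟨$⟩ʳ x) mod r) → toℕ (π ⟨$⟩ʳ x) mod r ≡ i
    from eq = transpose-injective i (m mod r) (trans (sym eq) (sym (transpose-self i (m mod r))))

  adj-punchIn : ∀ x y → adj G (punchIn v x) (punchIn v y)
                      ≡ adj (turán r (suc m)) (ρ ⟨$⟩ʳ punchIn v x) (ρ ⟨$⟩ʳ punchIn v y)
  adj-punchIn x y = begin
    adj (G ─ v) x y
      ≡⟨ G-v≅ x y ⟩
    not (does (toℕ (π ⟨$⟩ʳ x) mod r ≟ toℕ (π ⟨$⟩ʳ y) mod r))
      ≡⟨ cong not (does-⇔ (mk⇔ (cong τ) (transpose-injective i (m mod r)))
           (toℕ (π ⟨$⟩ʳ x) mod r ≟ toℕ (π ⟨$⟩ʳ y) mod r) (τ (toℕ (π ⟨$⟩ʳ x) mod r) ≟ τ (toℕ (π ⟨$⟩ʳ y) mod r))) ⟩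
    not (does (τ (toℕ (π ⟨$⟩ʳ x) mod r) ≟ τ (toℕ (π ⟨$⟩ʳ y) mod r)))
      ≡⟨ cong₂ (λ a b → not (does (a ≟ b))) (ρ-punchIn x) (ρ-punchIn y) ⟨
    adj (turán r (suc m)) (ρ ⟨$⟩ʳ punchIn v x) (ρ ⟨$⟩ʳ punchIn v y) ∎
    where open ≡-Reasoning

  Preserved : Fin (suc m) → Fin (suc m) → Set
  Preserved u w = adj G u w ≡ adj (turán r (suc m)) (ρ ⟨$⟩ʳ u) (ρ ⟨$⟩ʳ w)

  preserved : ∀ {u w} → u ≡ v ⊎ ∃[ x ] u ≡ punchIn v x → w ≡ v ⊎ ∃[ y ] w ≡ punchIn v y → Preserved u w
  preserved (inj₁ refl)       (inj₁ refl)       = trans (adj-irrefl G v) (sym (adj-irrefl (turán r (suc m)) (ρ ⟨$⟩ʳ v)))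
  preserved (inj₁ refl)       (inj₂ (y , refl)) = adj-v y
  preserved (inj₂ (x , refl)) (inj₁ refl)       = trans (adj-sym G (punchIn v x) v)
    (trans (adj-v x) (adj-sym (turán r (suc m)) (ρ ⟨$⟩ʳ v) (ρ ⟨$⟩ʳ punchIn v x)))
  preserved (inj₂ (x , refl)) (inj₂ (y , refl)) = adj-punchIn x y

  adj≡ : ∀ u w → Preserved u w
  adj≡ u w = preserved (punchIn-cases v u) (punchIn-cases v w)

+-squeeze : ∀ {a b c d} → a ≤ b → c ≤ d → a + c ≡ b + d → a ≡ b × c ≡ d
+-squeeze {a} {b} {c} {d} a≤b c≤d eq with ℕ.m≤n⇒m<n∨m≡n a≤b
... | inj₁ a<b  = ⊥-elim (ℕ.<-irrefl eq (+-mono-<-≤ a<b c≤d))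
... | inj₂ refl = refl , +-cancelˡ-≡ a c d eq

-- Induction by deleting a vertex of degree at most m - ⌊m/r⌋; if there is none, the greedy argument
-- finds a clique of r + 1 vertices. Equality forces equality both in the degree and in the
-- induction hypothesis, and `extend-turán` puts the vertex back.
turán-theorem : ∀ r .{{_ : NonZero r}} n (G : Graph n) → CliqueFree (suc r) G →
                e G ≤ turánSize r n × (e G ≡ turánSize r n → G ≅ turán r n)
turán-theorem r zero    G free = z≤n , λ _ → Perm.id , λ ()
turán-theorem r (suc m) G free with any? (λ v → deg G v ℕ.≤? m ∸ m / r)
... | yes (v , deg-v≤) =
  let (e≤ , ≅turán) = turán-theorem r m (G ─ v) (cliqueFree-─ {G = G} v free)
      e≡ = trans (e-─ G v) (+-comm (deg G v) _)
  in subst (_≤ turánSize r (suc m)) (sym e≡) (+-mono-≤ e≤ deg-v≤)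
   , λ eq → let (e-v , deg-v) = +-squeeze e≤ deg-v≤ (trans (sym e≡) eq)
            in extend-turán G v free deg-v (≅turán e-v)
... | no ¬small = ⊥-elim (free (greedyClique G (m / r) r dense
        (s≤s (subst (_≤ m) (ℕ.*-comm (m / r) r) (m/n*n≤m m r)))))
  where
  dense : ∀ v → suc m ≤ deg G v + m / r
  dense v = subst (λ a → suc a ≤ deg G v + m / r) (ℕ.m∸n+n≡m (m/n≤m m r))
    (ℕ.+-monoˡ-≤ (m / r) (ℕ.≰⇒> λ small → ¬small (v , small)))

-- Closure and deletion of vertices of small degree

0<count⇒∃ : ∀ {n} (p : Fin n → Bool) → 0 < count p → ∃[ i ] p i ≡ true
0<count⇒∃ {suc n} p 0<count with p zero in p₀
... | true  = zero , p₀
... | false = let (i , pi) = 0<count⇒∃ (p ∘ suc) 0<count in suc i , pi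

∃⇒0<count : ∀ {n} (p : Fin n → Bool) i → p i ≡ true → 0 < count p
∃⇒0<count {suc n} p i pi = begin
  1                                   ≡⟨ cong 𝟙 pi ⟨
  𝟙 (p i)                             ≤⟨ ℕ.m≤m+n _ _ ⟩
  𝟙 (p i) + count (p ∘ punchIn i)     ≡⟨ sum-remove {i = i} (𝟙 ∘ p) ⟨
  count p                             ∎
  where open ≤-Reasoning

lowCount : ∀ {n} → ℕ → Graph n → ℕ
lowCount k G = count (λ v → deg G v ℕ.≤ᵇ k)

≤⇒≤ᵇ≡true : ∀ {a b} → a ≤ b → (a ℕ.≤ᵇ b) ≡ true
≤⇒≤ᵇ≡true a≤b = T⇒≡true (ℕ.≤⇒≤ᵇ a≤b)

≤ᵇ≡true⇒≤ : ∀ {a b} → (a ℕ.≤ᵇ b) ≡ true → a ≤ b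
≤ᵇ≡true⇒≤ eq = ℕ.≤ᵇ⇒≤ _ _ (≡true⇒T eq)

lowVertex : ∀ {n k} (G : Graph n) → 0 < lowCount k G → ∃[ v ] deg G v ≤ k
lowVertex G 0<low = let (v , low) = 0<count⇒∃ _ 0<low in v , ≤ᵇ≡true⇒≤ low

-- Deletion never raises a degree, so every low vertex other than `v` stays low.
lowCount-─ : ∀ {n} k (G : Graph (suc n)) v → lowCount k G ≤ suc (lowCount k (G ─ v))
lowCount-─ k G v = begin
  lowCount k G
    ≡⟨ sum-remove {i = v} (λ u → 𝟙 (deg G u ℕ.≤ᵇ k)) ⟩
  𝟙 (deg G v ℕ.≤ᵇ k) + count (λ u → deg G (punchIn v u) ℕ.≤ᵇ k)
    ≤⟨ +-mono-≤ (𝟙≤1 _) (count-mono-≤ low) ⟩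
  suc (lowCount k (G ─ v)) ∎
  where
  open ≤-Reasoning
  𝟙≤1 : ∀ a → 𝟙 a ≤ 1
  𝟙≤1 true  = ≤-refl
  𝟙≤1 false = z≤n

  low : ∀ u → (deg G (punchIn v u) ℕ.≤ᵇ k) ≡ true → (deg (G ─ v) u ℕ.≤ᵇ k) ≡ true
  low u eq = ≤⇒≤ᵇ≡true (≤-trans (ℕ.m≤n+m (deg (G ─ v) u) (𝟙 (adj G v (punchIn v u)))) (subst (_≤ k) (deg-─ G v u) (≤ᵇ≡true⇒≤ eq)))

e≤lowVertices : ∀ {r} .{{_ : NonZero r}} k c {n} (G : Graph n) → CliqueFree (suc r) G →
                c ≤ lowCount k G → e G ≤ c * k + turánSize r (n ∸ c)
e≤lowVertices k zero    {n}     G free _     = proj₁ (turán-theorem _ n G free)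
e≤lowVertices {r} k (suc c) {suc m} G free c<low = begin
  e G                                         ≡⟨ e-─ G v ⟩
  deg G v + e (G ─ v)                         ≤⟨ +-mono-≤ (proj₂ low) (e≤lowVertices k c (G ─ v)
                                                   (cliqueFree-─ {G = G} v free)
                                                   (ℕ.s≤s⁻¹ (≤-trans c<low (lowCount-─ k G v)))) ⟩
  k + (c * k + turánSize r (m ∸ c))           ≡⟨ +-assoc k (c * k) _ ⟨
  suc c * k + turánSize r (m ∸ c)             ∎
  where
  open ≤-Reasoning
  low : ∃[ v ] deg G v ≤ k
  low = lowVertex G (ℕ.<-≤-trans (s≤s z≤n) c<low)
  v = proj₁ low

-- Improvement until nothing can be improved; it produces both the closure and a nonadjacent pair of
-- maximal degree sum.
descend : ∀ {a b} {X : Set a} {Q : X → Set b} (μ : X → ℕ) →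
          (∀ x → (∃[ y ] μ y < μ x) ⊎ Q x) → X → ∃ Q
descend {X = X} {Q} μ step x = go x (<-wellFounded (μ x))
  where
  go : ∀ x → Acc _<_ (μ x) → ∃ Q
  go x (acc rec) with step x
  ... | inj₁ (y , y<x) = go y (rec y<x)
  ... | inj₂ q         = x , q

infix 4 _⊆_
_⊆_ : ∀ {n} → Graph n → Graph n → Set
G ⊆ H = ∀ u v → adj G u v ≡ true → adj H u v ≡ true

deg-⊆ : ∀ {n} {G H : Graph n} → G ⊆ H → ∀ u → deg G u ≤ deg H u
deg-⊆ {G = G} {H} G⊆H u =
  subst₂ _≤_ (sym (deg≡count G u)) (sym (deg≡count H u)) (count-mono-≤ (G⊆H u))

deg≤n : ∀ {n} (G : Graph n) u → deg G u ≤ n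
deg≤n G u = subst (_≤ _) (sym (deg≡count G u)) (count≤n (adj G u))

⊆-addEdge : ∀ {n} (G : Graph n) u v (u≢v : u ≢ v) → G ⊆ addEdge G u v u≢v
⊆-addEdge G u v u≢v x y xy rewrite xy = refl

adj-addEdge : ∀ {n} (G : Graph n) u v (u≢v : u ≢ v) → adj (addEdge G u v u≢v) u v ≡ true
adj-addEdge G u v u≢v rewrite dec-true (u ≟ u) refl | dec-true (v ≟ v) refl = Bool.∨-zeroʳ (adj G u v)

-- Termination measure of the closure. Counting ordered pairs and the diagonal is harmless, since
-- only the decrease is used.
gaps : ∀ {n} → Graph n → ℕ
gaps G = sum (λ u → count (not ∘ adj G u))

gaps-addEdge : ∀ {n} (G : Graph n) u v (u≢v : u ≢ v) → adj G u v ≡ false →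
               gaps (addEdge G u v u≢v) < gaps G
gaps-addEdge G u v u≢v ¬uv = sum-mono-< (λ x → count-mono-≤ (fewer x)) u
  (count-mono-< (fewer u) v (cong not (adj-addEdge G u v u≢v)) (cong not ¬uv))
  where
  fewer : ∀ x y → not (adj (addEdge G u v u≢v) x y) ≡ true → not (adj G x y) ≡ true
  fewer x y ¬xy with adj G x y
  ... | false = refl

Gap : ∀ {n} → Graph n → Fin n → Fin n → Set
Gap G u v = u ≢ v × adj G u v ≡ false

gap? : ∀ {n} (G : Graph n) u v → Dec (Gap G u v)
gap? G u v = ¬? (u ≟ v) ×-dec (adj G u v Bool.≟ false)

-- It is applied with s = n + L and L = ℓ + 1, one above the stability threshold; the successor
-- compensates, so the condition reads deg u + deg v < n + ℓ.
Closed : ∀ {n} → ℕ → Graph n → Set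
Closed s H = ∀ u v → Gap H u v → suc (deg H u + deg H v) < s

closure : ∀ {p n} (P : Graph n → Set p) (s : ℕ) →
          (∀ G u v (u≢v : u ≢ v) → adj G u v ≡ false → P (addEdge G u v u≢v) →
             s ≤ suc (deg G u + deg G v) → P G) →
          ∀ G → ¬ P G → ∃[ H ] (G ⊆ H × ¬ P H × Closed s H)
closure {p} {n} P s stable G ¬PG =
  let ((H , G⊆H , ¬PH) , closed) = descend (gaps ∘ proj₁) step (G , (λ _ _ uv → uv) , ¬PG)
  in H , G⊆H , ¬PH , closed
  where
  Stage : Set p
  Stage = ∃[ H ] (G ⊆ H × ¬ P H)

  step : (st : Stage) → (∃[ st′ ] gaps (proj₁ {B = λ H → G ⊆ H × ¬ P H} st′) < gaps (proj₁ st)) ⊎ Closed s (proj₁ st)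
  step (H , G⊆H , ¬PH) with any? (λ u → any? (λ v → gap? H u v ×-dec (s ℕ.≤? suc (deg H u + deg H v))))
  ... | yes (u , v , (u≢v , ¬uv) , s≤) = inj₁
    ( ( addEdge H u v u≢v
      , (λ x y xy → ⊆-addEdge H u v u≢v x y (G⊆H x y xy))
      , (λ PH+uv → ¬PH (stable H u v u≢v ¬uv PH+uv s≤)) )
    , gaps-addEdge H u v u≢v ¬uv )
  ... | no ¬gap = inj₂ λ u v uv → ℕ.≰⇒> λ s≤ → ¬gap (u , v , uv , s≤)

maximalGap : ∀ {n} (H : Graph n) {u v} → Gap H u v →
             ∃[ u ] ∃[ v ] (Gap H u v × (∀ x y → Gap H x y → deg H x + deg H y ≤ deg H u + deg H v))
maximalGap {n} H {u₀} {v₀} gap₀ =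
  -- No degree sum exceeds n + n, so subtracting from it turns maximisation into descent.
  let (((u , v) , uv) , maximal) = descend {Q = Maximal} (λ g → n + n ∸ size g) step ((u₀ , v₀) , gap₀)
  in u , v , uv , maximal
  where
  GapPair : Set
  GapPair = ∃ λ ((u , v) : Fin n × Fin n) → Gap H u v

  size : GapPair → ℕ
  size ((u , v) , _) = deg H u + deg H v

  Maximal : GapPair → Set
  Maximal g = ∀ x y → Gap H x y → deg H x + deg H y ≤ size g

  step : (g : GapPair) → (∃[ h ] n + n ∸ size h < n + n ∸ size g) ⊎ Maximal g
  step g with any? (λ x → any? (λ y → gap? H x y ×-dec (size g ℕ.<? deg H x + deg H y)))
  ... | yes (x , y , xy , larger) =
    inj₁ (((x , y) , xy) , ℕ.∸-monoʳ-< larger (+-mono-≤ (deg≤n H x) (deg≤n H y)))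
  ... | no ¬larger = inj₂ λ x y xy → ℕ.≮⇒≥ λ larger → ¬larger (x , y , xy , larger)

-- Apart from `v` itself, the n - 1 - deg v non-neighbours of `v` in `H` have degree at most k = deg
-- u there, hence also in `G`; `u` is one of them. The closedness bound on k + deg v compares their
-- number with k + 1 - L, and k ≤ deg v gives the last inequality.
lowDegrees : ∀ {n} L (G H : Graph n) {u v} → G ⊆ H → Gap H u v → deg H u ≤ deg H v →
             suc (deg H u + deg H v) < n + L →
             (∀ w → Gap H w v → deg H w ≤ deg H u) →
             ∃[ k ] (0 < lowCount k G × suc k ≤ lowCount k G + L × 2 + (k + k) ≤ n + L)
lowDegrees {suc m} L G H {u} {v} G⊆H uv du≤dv du+dv<s maximal =
  k , ∃⇒0<count (λ w → deg G w ℕ.≤ᵇ k) u (low u uv) , k<low+L , ≤-trans (ℕ.+-monoʳ-≤ (2 + k) du≤dv) du+dv<s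
  where
  k = deg H u

  low : ∀ w → Gap H w v → (deg G w ℕ.≤ᵇ k) ≡ true
  low w wv = ≤⇒≤ᵇ≡true (≤-trans (deg-⊆ {G = G} {H} G⊆H w) (maximal w wv))

  n≤dv+1+low : suc m ≤ deg H v + suc (lowCount k G)
  n≤dv+1+low = begin
    suc m                                                     ≡⟨ count-not (adj H v) ⟨
    count (adj H v) + count (not ∘ adj H v)                   ≡⟨ cong₂ _+_ (sym (deg≡count H v)) (sum-remove {i = v} (𝟙 ∘ not ∘ adj H v)) ⟩
    deg H v + (𝟙 (not (adj H v v)) + count (not ∘ adj H v ∘ punchIn v))
      ≤⟨ ℕ.+-monoʳ-≤ (deg H v) (+-mono-≤ (≤-reflexive (cong (𝟙 ∘ not) (adj-irrefl H v))) (count-mono-≤ nonAdj⇒low)) ⟩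
    deg H v + suc (count (λ w → deg G (punchIn v w) ℕ.≤ᵇ k))
      ≤⟨ ℕ.+-monoʳ-≤ (deg H v) (s≤s (≤-trans (ℕ.m≤n+m _ _) (≤-reflexive (sym (sum-remove {i = v} (λ w → 𝟙 (deg G w ℕ.≤ᵇ k))))))) ⟩
    deg H v + suc (lowCount k G)                              ∎
    where
    open ≤-Reasoning
    nonAdj⇒low : ∀ w → not (adj H v (punchIn v w)) ≡ true → (deg G (punchIn v w) ℕ.≤ᵇ k) ≡ true
    nonAdj⇒low w ¬vw = low (punchIn v w) (punchInᵢ≢i v w , trans (adj-sym H _ v) (not-injective ¬vw))

  k<low+L : suc k ≤ lowCount k G + L
  k<low+L = ℕ.+-cancelˡ-≤ (suc (deg H v)) _ _ (begin
    suc (deg H v) + suc k               ≡⟨ rearrange (deg H v) k ⟩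
    2 + (k + deg H v)                   ≤⟨ du+dv<s ⟩
    suc m + L                           ≤⟨ ℕ.+-monoˡ-≤ L n≤dv+1+low ⟩
    deg H v + suc (lowCount k G) + L    ≡⟨ rearrange′ (deg H v) (lowCount k G) L ⟩
    suc (deg H v) + (lowCount k G + L)  ∎)
    where
    open ≤-Reasoning
    rearrange : ∀ a b → suc a + suc b ≡ 2 + (b + a)
    rearrange = solve-∀
    rearrange′ : ∀ a b c → a + suc b + c ≡ suc a + (b + c)
    rearrange′ = solve-∀

¬P⇒lowDegrees : ∀ {p n} (P : Graph n → Set p) L →
  (∀ {G H} → G ≅ H → P G → P H) → P (K n) →
  (∀ G u v (u≢v : u ≢ v) → adj G u v ≡ false → P (addEdge G u v u≢v) →
     n + L ≤ suc (deg G u + deg G v) → P G) →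
  ∀ G → ¬ P G → ∃[ k ] (0 < lowCount k G × suc k ≤ lowCount k G + L × 2 + (k + k) ≤ n + L)
¬P⇒lowDegrees {n = n} P L resp PK stable G ¬PG with closure P (n + L) stable G ¬PG
... | H , G⊆H , ¬PH , closed with any? (λ u → any? (gap? H u))
-- Without a gap the closure would be the complete graph, which has the property.
...   | no ¬gap = ⊥-elim (¬PH (resp {K n} {H} (≅-pointwise {G = K n} {H} complete) PK))
  where
  complete : ∀ u v → not (does (u ≟ v)) ≡ adj H u v
  complete u v with u ≟ v
  ... | yes refl = sym (adj-irrefl H u)
  ... | no  u≢v  = sym (¬-not λ ¬uv → ¬gap (u , v , u≢v , ¬uv))
...   | yes (u₀ , v₀ , gap₀) with maximalGap H gap₀
...     | u , v , (u≢v , ¬uv) , maximal with ℕ.≤-total (deg H u) (deg H v)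
-- With the endpoint of larger degree kept fixed, maximality of the sum bounds the degree of each of
-- its non-neighbours.
...       | inj₁ du≤dv = lowDegrees L G H G⊆H (u≢v , ¬uv) du≤dv (closed u v (u≢v , ¬uv))
  λ w wv → ℕ.+-cancelʳ-≤ (deg H v) _ _ (maximal w v wv)
...       | inj₂ dv≤du = lowDegrees L G H G⊆H vu dv≤du (closed v u vu)
  λ w wu → ℕ.+-cancelʳ-≤ (deg H u) _ _ (≤-trans (maximal w u wu) (≤-reflexive (+-comm (deg H u) _)))
  where
  vu : Gap H v u
  vu = u≢v ∘ sym , trans (adj-sym H v u) ¬uv

-- The bounds on n

1+m/r≤ : ∀ m r .{{_ : NonZero r}} → suc m / r ≤ suc (m / r)
1+m/r≤ m r = begin
  suc m / r                           ≡⟨ cong (λ a → suc a / r) (m≡m%n+[m/n]*n m r) ⟩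
  (suc (m % r) + m / r * r) / r       ≤⟨ /-monoˡ-≤ r (ℕ.+-monoˡ-≤ (m / r * r) (m%n<n m r)) ⟩
  suc (m / r) * r / r                 ≡⟨ m*n/n≡m (suc (m / r)) r ⟩
  suc (m / r)                         ∎
  where open ≤-Reasoning

∸/-mono-≤ : ∀ r .{{_ : NonZero r}} {x y} → x ≤ y → x ∸ x / r ≤ y ∸ y / r
∸/-mono-≤ r x≤y = go (ℕ.≤⇒≤′ x≤y)
  where
  go : ∀ {x y} → x ℕ.≤′ y → x ∸ x / r ≤ y ∸ y / r
  go ℕ.≤′-refl = ≤-refl
  go (ℕ.≤′-step {y} x≤y) = ≤-trans (go x≤y) (ℕ.∸-monoʳ-≤ (suc y) (1+m/r≤ y r))

-- The binomial coefficient d(d-1)/2.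
triangle : ℕ → ℕ
triangle zero    = 0
triangle (suc d) = triangle d + d

-- With r = q + 1, vertex x adds at least q x / r edges; this is summed over m ≤ x < m + d and
-- multiplied by r to avoid division.
turánSize-growth : ∀ q m d → suc q * turánSize (suc q) m + q * (d * m + triangle d) ≤ suc q * turánSize (suc q) (d + m)
turánSize-growth q m zero    = ≤-reflexive (trans (cong (ℕ._+_ (suc q * turánSize (suc q) m)) (ℕ.*-zeroʳ q)) (ℕ.+-identityʳ _))
turánSize-growth q m (suc d) = begin
  suc q * t m + q * (suc d * m + (triangle d + d))              ≡⟨ rearrange (suc q * t m) q m d (triangle d) ⟩
  (suc q * t m + q * (d * m + triangle d)) + q * (d + m)        ≤⟨ +-mono-≤ (turánSize-growth q m d) (step (d + m)) ⟩
  suc q * t (d + m) + suc q * ((d + m) ∸ (d + m) / suc q)       ≡⟨ ℕ.*-distribˡ-+ (suc q) (t (d + m)) _ ⟨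
  suc q * t (suc d + m)                                         ∎
  where
  open ≤-Reasoning
  t = turánSize (suc q)

  rearrange : ∀ a q m d e → a + q * (suc d * m + (e + d)) ≡ (a + q * (d * m + e)) + q * (d + m)
  rearrange = solve-∀

  step : ∀ x → q * x ≤ suc q * (x ∸ x / suc q)
  step x = begin
    q * x                                   ≡⟨ ℕ.m+n∸m≡n x (q * x) ⟨
    suc q * x ∸ x                           ≤⟨ ℕ.∸-monoʳ-≤ (suc q * x) (subst (_≤ x) (ℕ.*-comm (x / suc q) (suc q)) (m/n*n≤m x (suc q))) ⟩
    suc q * x ∸ suc q * (x / suc q)         ≡⟨ ℕ.*-distribˡ-∸ (suc q) x (x / suc q) ⟨
    suc q * (x ∸ x / suc q)                 ∎

-- Deleting c vertices of degree k loses to the extremal graph for every k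
-- that the closure argument allows.
record Beaten (r : ℕ) .{{_ : NonZero r}} (L n c : ℕ) : Set where
  constructor beaten
  field
    2≤c    : 2 ≤ c
    2c+L≤n : 2 * c + L ≤ n
    bound  : ∀ k → 2 + (k + k) ≤ n + L → c * k + turánSize r (n ∸ c) < L + turánSize r (n ∸ 1)

-- Everything is scaled by 2r: k is replaced by its upper bound (n + L - 2) / 2, where n = c + m,
-- and the difference of the two Turán numbers by its linear lower bound.
bound-linear : ∀ q L d m → let r = suc q; c = suc d in
  r * (c * (c + m + L)) < 2 * r * L + 2 * r * c + 2 * q * (d * m + triangle d) →
  ∀ k → 2 + (k + k) ≤ c + m + L → c * k + turánSize r m < L + turánSize r (d + m)
bound-linear q L d m lin k 2k+2≤ = ℕ.*-cancelˡ-< (2 * r) _ _ (ℕ.+-cancelˡ-< (2 * r * c) _ _ (begin-strict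
  2 * r * c + 2 * r * (c * k + t m)                                     ≡⟨ rearrange₁ r c k (t m) ⟩
  r * (c * (2 + (k + k))) + 2 * (r * t m)                               ≤⟨ ℕ.+-monoˡ-≤ _ (ℕ.*-monoʳ-≤ r (ℕ.*-monoʳ-≤ c 2k+2≤)) ⟩
  r * (c * (c + m + L)) + 2 * (r * t m)                                 <⟨ ℕ.+-monoˡ-< _ lin ⟩
  2 * r * L + 2 * r * c + 2 * q * (d * m + triangle d) + 2 * (r * t m)  ≡⟨ rearrange₂ r c L q (d * m + triangle d) (t m) ⟩
  2 * r * L + 2 * r * c + 2 * (r * t m + q * (d * m + triangle d))      ≤⟨ ℕ.+-monoʳ-≤ (2 * r * L + 2 * r * c) (ℕ.*-monoʳ-≤ 2 (turánSize-growth q m d)) ⟩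
  2 * r * L + 2 * r * c + 2 * (r * t (d + m))                           ≡⟨ rearrange₃ r c L (t (d + m)) ⟩
  2 * r * c + 2 * r * (L + t (d + m))                                   ∎))
  where
  open ≤-Reasoning
  r = suc q
  c = suc d
  t = turánSize r
  rearrange₁ : ∀ r c k t → 2 * r * c + 2 * r * (c * k + t) ≡ r * (c * (2 + (k + k))) + 2 * (r * t)
  rearrange₁ = solve-∀
  rearrange₂ : ∀ r c L q e t → 2 * r * L + 2 * r * c + 2 * q * e + 2 * (r * t) ≡ 2 * r * L + 2 * r * c + 2 * (r * t + q * e)
  rearrange₂ = solve-∀
  rearrange₃ : ∀ r c L t → 2 * r * L + 2 * r * c + 2 * (r * t) ≡ 2 * r * c + 2 * r * (L + t)
  rearrange₃ = solve-∀

-- Here a ≤ b is the combination of hypotheses that proves k x < k y, and s is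
-- the slack left over; the remaining identity has no subtraction.
linear-< : ∀ k {a b x y} s → a ≤ b → suc (k * x) + b + s ≡ k * y + a → x < y
linear-< k {a} {b} {x} {y} s a≤b eq = ℕ.*-cancelˡ-< k x y (ℕ.+-cancelʳ-≤ a _ _ (begin
  suc (k * x) + a       ≤⟨ ℕ.+-monoʳ-≤ (suc (k * x)) a≤b ⟩
  suc (k * x) + b       ≤⟨ ℕ.m≤m+n _ s ⟩
  suc (k * x) + b + s   ≡⟨ eq ⟩
  k * y + a             ∎))
  where open ≤-Reasoning

linear-≤ : ∀ k {a b x y} s → a ≤ b → suc (k * x) + b + s ≡ k * suc y + a → x ≤ y
linear-≤ k s a≤b eq = ℕ.s≤s⁻¹ (linear-< k s a≤b eq)

_⊕_ : ∀ {a b c d} → a ≤ b → c ≤ d → a + c ≤ b + d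
_⊕_ = +-mono-≤

_⊛_ : ∀ k {a b} → a ≤ b → k * a ≤ k * b
k ⊛ a≤b = ℕ.*-monoʳ-≤ k a≤b

infixl 6 _⊕_
infixl 7 _⊛_

-- Finite search for small n and linear estimates for large n

BeatenAtMax : ∀ r .{{_ : NonZero r}} L n c → Set
BeatenAtMax r L n c = 2 ≤ c × 2 * c + L ≤ n ×
  c * ((n + L ∸ 2) / 2) + turánSize r (n ∸ c) < L + turánSize r (n ∸ 1)

beatenAtMax? : ∀ r .{{_ : NonZero r}} L n c → Dec (BeatenAtMax r L n c)
beatenAtMax? r L n c = (2 ℕ.≤? c) ×-dec ((2 * c + L ℕ.≤? n) ×-dec
  (c * ((n + L ∸ 2) / 2) + turánSize r (n ∸ c) ℕ.<? L + turánSize r (n ∸ 1)))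

-- The bound is monotone in k, so the largest admissible value ⌊(n + L - 2) / 2⌋ decides it for all
-- k and makes the condition testable.
beatenAtMax⇒beaten : ∀ {r} .{{_ : NonZero r}} {L n c} → BeatenAtMax r L n c → Beaten r L n c
beatenAtMax⇒beaten {r} {L} {n} {c} (2≤c , 2c+L≤n , b) = beaten 2≤c 2c+L≤n λ k 2k+2≤ →
  ℕ.≤-<-trans (ℕ.+-monoˡ-≤ _ (ℕ.*-monoʳ-≤ c (k≤ k 2k+2≤))) b
  where
  open ≤-Reasoning
  k≤ : ∀ k → 2 + (k + k) ≤ n + L → k ≤ (n + L ∸ 2) / 2
  k≤ k 2k+2≤ = begin
    k                   ≡⟨ m*n/n≡m k 2 ⟨
    k * 2 / 2           ≤⟨ /-monoˡ-≤ 2 (subst (_≤ n + L ∸ 2) (double k) (ℕ.∸-monoˡ-≤ 2 2k+2≤)) ⟩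
    (n + L ∸ 2) / 2     ∎
    where
    double : ∀ k → k + k ≡ k * 2
    double = solve-∀

-- The bounds of the theorem for 4 ≤ r ≤ 7, with denominators cleared.
Large : ℕ → ℕ → ℕ → Set
Large r L n = (2 + L) * (r ∸ 3) + 4 * (L + 1) ≤ n * (r ∸ 3)
            × (4 + L) * (2 * r ∸ 2) + (r + 2 * L + 5) ≤ n * (2 * r ∸ 2)

large? : ∀ r L n → Dec (Large r L n)
large? r L n = (_ ℕ.≤? _) ×-dec (_ ℕ.≤? _)

-- The exceptional conditions in terms of L = ℓ + 1: ℓ = -1 on the left, ℓ ≥ 0 on the right.
-- Exceeding a minimum means exceeding one of its two arguments, and n > a - 1 - ℓ becomes n + L >
-- a.
NotSmall : ℕ → ℕ → ℕ → ℕ → Set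
NotSmall a b L n = (L ≡ 0 × 5 < n) ⊎ (1 ≤ L × (a < n + L ⊎ b * L < n))

notSmall? : ∀ a b L n → Dec (NotSmall a b L n)
notSmall? a b L n = ((L ℕ.≟ 0) ×-dec (5 ℕ.<? n)) ⊎-dec ((1 ℕ.≤? L) ×-dec ((a ℕ.<? n + L) ⊎-dec (b * L ℕ.<? n)))

Search : (ℕ → ℕ → Set) → (r : ℕ) .{{_ : NonZero r}} → ℕ → Set
Search Hyp r N = ∀ {n} → n < N → ∀ {L} → L < N → Hyp L n → ∃[ c ] (c < 8 × BeatenAtMax r L n c)

search : ∀ {Hyp} → (∀ L n → Dec (Hyp L n)) → ∀ r .{{_ : NonZero r}} N → Dec (Search Hyp r N)
search hyp? r N = ℕ.allUpTo? (λ n → ℕ.allUpTo? (λ L → hyp? L n →-dec ℕ.anyUpTo? (beatenAtMax? r L n) 8) N) N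

searched : ∀ {Hyp r} .{{_ : NonZero r}} {N} → Search Hyp r N → ∀ {L n} → n < N → L ≤ n → Hyp L n → ∃[ c ] Beaten r L n c
searched found n<N L≤n hyp =
  let (c , _ , b) = found n<N (ℕ.≤-<-trans L≤n n<N) hyp in c , beatenAtMax⇒beaten b

-- Verified by evaluating the decision procedure. The limit 33, like its counterparts for the other
-- r, is where the uniform choice of c takes over.
small₃ : Search (λ L n → 6 * L + 20 ≤ n) 3 33
small₃ = from-yes (search (λ L n → 6 * L + 20 ℕ.≤? n) 3 33)

small₄ : Search (λ L n → Large 4 L n × 14 < n + L) 4 19
small₄ = from-yes (search (λ L n → large? 4 L n ×-dec (14 ℕ.<? n + L)) 4 19)

small₅ : Search (λ L n → Large 5 L n × NotSmall 18 10 L n) 5 22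
small₅ = from-yes (search (λ L n → large? 5 L n ×-dec notSmall? 18 10 L n) 5 22)

small₆ : Search (λ L n → Large 6 L n × NotSmall 22 6 L n) 6 30
small₆ = from-yes (search (λ L n → large? 6 L n ×-dec notSmall? 22 6 L n) 6 30)

small₇ : Search (λ L n → Large 7 L n × NotSmall 26 6 L n) 7 32
small₇ = from-yes (search (λ L n → large? 7 L n ×-dec notSmall? 26 6 L n) 7 32)

-- Both inequalities are nonnegative combinations of the two hypotheses, with multipliers chosen so
-- that L and m cancel and a constant slack remains. In `eq₂` the number 15 is `triangle 6`. The
-- cases r = 4, ..., 7 follow the same pattern.
large₃ : ∀ L m → 6 * L + 20 ≤ 7 + m → 33 ≤ 7 + m → Beaten 3 L (7 + m) 7
large₃ L m h g = beaten (s≤s (s≤s z≤n)) (linear-≤ 6 106 (h ⊕ 5 ⊛ g) (eq₁ L (7 + m)))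
  (bound-linear 2 L 6 m (linear-< 2 0 (5 ⊛ h ⊕ g) (eq₂ L m)))
  where
  eq₁ : ∀ L n → suc (6 * (14 + L)) + (n + 5 * n) + 106 ≡ 6 * suc n + (6 * L + 20 + 5 * 33)
  eq₁ = solve-∀
  eq₂ : ∀ L m → suc (2 * (3 * (7 * (7 + m + L)))) + (5 * (7 + m) + (7 + m)) + 0
              ≡ 2 * (6 * L + 42 + 4 * (6 * m + 15)) + (5 * (6 * L + 20) + 33)
  eq₂ = solve-∀

large₄ : ∀ L m → (2 + L) * 1 + 4 * (L + 1) ≤ (6 + m) * 1 → 19 ≤ 6 + m → Beaten 4 L (6 + m) 6
large₄ L m h g = beaten (s≤s (s≤s z≤n)) (linear-≤ 5 26 (h ⊕ 4 ⊛ g) (eq₁ L (6 + m)))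
  (bound-linear 3 L 5 m (linear-< 5 1 (16 ⊛ h ⊕ 14 ⊛ g) (eq₂ L m)))
  where
  eq₁ : ∀ L n → suc (5 * (12 + L)) + (n * 1 + 4 * n) + 26 ≡ 5 * suc n + ((2 + L) * 1 + 4 * (L + 1) + 4 * 19)
  eq₁ = solve-∀
  eq₂ : ∀ L m → suc (5 * (4 * (6 * (6 + m + L)))) + (16 * ((6 + m) * 1) + 14 * (6 + m)) + 1
              ≡ 5 * (8 * L + 48 + 6 * (5 * m + 10)) + (16 * ((2 + L) * 1 + 4 * (L + 1)) + 14 * 19)
  eq₂ = solve-∀

large₅ : ∀ L m → (2 + L) * 2 + 4 * (L + 1) ≤ (5 + m) * 2 → 22 ≤ 5 + m → Beaten 5 L (5 + m) 5
large₅ L m h g = beaten (s≤s (s≤s z≤n)) (linear-≤ 6 41 (h ⊕ 4 ⊛ g) (eq₁ L (5 + m)))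
  (bound-linear 4 L 4 m (linear-< 2 3 (5 ⊛ h ⊕ 4 ⊛ g) (eq₂ L m)))
  where
  eq₁ : ∀ L n → suc (6 * (10 + L)) + (n * 2 + 4 * n) + 41 ≡ 6 * suc n + ((2 + L) * 2 + 4 * (L + 1) + 4 * 22)
  eq₁ = solve-∀
  eq₂ : ∀ L m → suc (2 * (5 * (5 * (5 + m + L)))) + (5 * ((5 + m) * 2) + 4 * (5 + m)) + 3
              ≡ 2 * (10 * L + 50 + 8 * (4 * m + 6)) + (5 * ((2 + L) * 2 + 4 * (L + 1)) + 4 * 22)
  eq₂ = solve-∀

large₆ : ∀ L m → (2 + L) * 3 + 4 * (L + 1) ≤ (4 + m) * 3 → 30 ≤ 4 + m → Beaten 6 L (4 + m) 4
large₆ L m h g = beaten (s≤s (s≤s z≤n)) (linear-≤ 7 80 (h ⊕ 4 ⊛ g) (eq₁ L (4 + m)))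
  (bound-linear 5 L 3 m (linear-< 7 5 (12 ⊛ h ⊕ 6 ⊛ g) (eq₂ L m)))
  where
  eq₁ : ∀ L n → suc (7 * (8 + L)) + (n * 3 + 4 * n) + 80 ≡ 7 * suc n + ((2 + L) * 3 + 4 * (L + 1) + 4 * 30)
  eq₁ = solve-∀
  eq₂ : ∀ L m → suc (7 * (6 * (4 * (4 + m + L)))) + (12 * ((4 + m) * 3) + 6 * (4 + m)) + 5
              ≡ 7 * (12 * L + 48 + 10 * (3 * m + 3)) + (12 * ((2 + L) * 3 + 4 * (L + 1)) + 6 * 30)
  eq₂ = solve-∀

large₇ : ∀ L m → (2 + L) * 4 + 4 * (L + 1) ≤ (4 + m) * 4 → 32 ≤ 4 + m → Beaten 7 L (4 + m) 4
large₇ L m h g = beaten (s≤s (s≤s z≤n)) (linear-≤ 8 83 (h ⊕ 4 ⊛ g) (eq₁ L (4 + m)))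
  (bound-linear 6 L 3 m (linear-< 4 3 (7 ⊛ h ⊕ 4 ⊛ g) (eq₂ L m)))
  where
  eq₁ : ∀ L n → suc (8 * (8 + L)) + (n * 4 + 4 * n) + 83 ≡ 8 * suc n + ((2 + L) * 4 + 4 * (L + 1) + 4 * 32)
  eq₁ = solve-∀
  eq₂ : ∀ L m → suc (4 * (7 * (4 * (4 + m + L)))) + (7 * ((4 + m) * 4) + 4 * (4 + m)) + 3
              ≡ 4 * (14 * L + 56 + 12 * (3 * m + 3)) + (7 * ((2 + L) * 4 + 4 * (L + 1)) + 4 * 32)
  eq₂ = solve-∀

cleared⇒≤ : ∀ d .{{_ : NonZero d}} a L n {x} → (a + L) * d + x ≤ n * d → a + L ≤ n
cleared⇒≤ d a L n h = ℕ.*-cancelʳ-≤ (a + L) n d (≤-trans (ℕ.m≤m+n _ _) h)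

module _ (r N d : ℕ) .{{_ : NonZero r}} {Hyp : ℕ → ℕ → Set}
         (found : Search Hyp r N) (suc-d≤N : suc d ≤ N) (hyp⇒L≤n : ∀ {L n} → Hyp L n → L ≤ n)
         (large : ∀ L m → Hyp L (suc d + m) → N ≤ suc d + m → Beaten r L (suc d + m) (suc d)) where

  smallOrLarge : ∀ L n → Hyp L n → ∃[ c ] Beaten r L n c
  smallOrLarge L n hyp with N ℕ.≤? n
  ... | no N≰n = searched found (ℕ.≰⇒> N≰n) (hyp⇒L≤n hyp) hyp
  ... | yes N≤n with m , refl ← ℕ.m≤n⇒∃[o]m+o≡n (≤-trans suc-d≤N N≤n) = suc d , large L m hyp N≤n

beaten₃ : ∀ L n → 6 * L + 20 ≤ n → ∃[ c ] Beaten 3 L n c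
beaten₃ = smallOrLarge 3 33 6 small₃ (ℕ.m≤m+n 7 26)
  (λ {L} h → ≤-trans (ℕ.m≤n*m L 6) (≤-trans (ℕ.m≤m+n (6 * L) 20) h)) large₃

beaten₄ : ∀ L n → Large 4 L n × 14 < n + L → ∃[ c ] Beaten 4 L n c
beaten₄ = smallOrLarge 4 19 5 small₄ (ℕ.m≤m+n 6 13)
  (λ {L} {n} ((h , _) , _) → ℕ.m+n≤o⇒n≤o 2 (cleared⇒≤ 1 2 L n h)) (λ L m ((h , _) , _) → large₄ L m h)

beaten₅ : ∀ L n → Large 5 L n × NotSmall 18 10 L n → ∃[ c ] Beaten 5 L n c
beaten₅ = smallOrLarge 5 22 4 small₅ (ℕ.m≤m+n 5 17)
  (λ {L} {n} ((h , _) , _) → ℕ.m+n≤o⇒n≤o 2 (cleared⇒≤ 2 2 L n h)) (λ L m ((h , _) , _) → large₅ L m h)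

beaten₆ : ∀ L n → Large 6 L n × NotSmall 22 6 L n → ∃[ c ] Beaten 6 L n c
beaten₆ = smallOrLarge 6 30 3 small₆ (ℕ.m≤m+n 4 26)
  (λ {L} {n} ((h , _) , _) → ℕ.m+n≤o⇒n≤o 2 (cleared⇒≤ 3 2 L n h)) (λ L m ((h , _) , _) → large₆ L m h)

beaten₇ : ∀ L n → Large 7 L n × NotSmall 26 6 L n → ∃[ c ] Beaten 7 L n c
beaten₇ = smallOrLarge 7 32 3 small₇ (ℕ.m≤m+n 4 28)
  (λ {L} {n} ((h , _) , _) → ℕ.m+n≤o⇒n≤o 2 (cleared⇒≤ 4 2 L n h)) (λ L m ((h , _) , _) → large₇ L m h)

-- At n = L + 5 the hypothesis forces r > L + 3, so the last vertex of T_r(n-1) is joined to all L +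
-- 3 others. Parity sharpens 2k + 2 ≤ 2L + 5 to k ≤ L + 1.
beaten₈-tight : ∀ q L → (4 + L) * (4 + q) + 4 * (L + 3) ≤ (5 + L) * (4 + q) → Beaten (8 + q) L (5 + L) 2
beaten₈-tight q L h = beaten ≤-refl (ℕ.+-monoˡ-≤ L (ℕ.n≤1+n 4)) bound
  where
  3+L<8+q : 3 + L < 8 + q
  3+L<8+q = linear-< 4 (27 + 3 * q) h (eq q L)
    where
    eq : ∀ q L → suc (4 * (3 + L)) + (5 + L) * (4 + q) + (27 + 3 * q) ≡ 4 * (8 + q) + ((4 + L) * (4 + q) + 4 * (L + 3))
    eq = solve-∀

  bound : ∀ k → 2 + (k + k) ≤ 5 + L + L → 2 * k + turánSize (8 + q) (3 + L) < L + turánSize (8 + q) (4 + L)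
  bound k 2k+2≤ = begin-strict
    2 * k + t                       ≤⟨ ℕ.+-monoˡ-≤ t (ℕ.*-monoʳ-≤ 2 (linear-≤ 2 {x = k} {y = 1 + L} 0 2k+2≤ (eq₁ k L))) ⟩
    2 * (1 + L) + t                 <⟨ ≤-reflexive (eq₂ L t) ⟩
    L + (t + (3 + L))               ≡⟨ cong (λ a → L + (t + (3 + L ∸ a))) (m<n⇒m/n≡0 3+L<8+q) ⟨
    L + turánSize (8 + q) (4 + L)   ∎
    where
    open ≤-Reasoning
    t = turánSize (8 + q) (3 + L)
    eq₁ : ∀ k L → suc (2 * k) + (5 + L + L) + 0 ≡ 2 * suc (1 + L) + (2 + (k + k))
    eq₁ = solve-∀
    eq₂ : ∀ L t → suc (2 * (1 + L) + t) ≡ L + (t + (3 + L))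
    eq₂ = solve-∀

5+L≤n : ∀ q L n → (4 + L) * (4 + q) + 4 * (L + 3) ≤ n * (4 + q) → 5 + L ≤ n
5+L≤n q L n h = ℕ.*-cancelʳ-< (4 + q) (4 + L) n (ℕ.<-≤-trans (ℕ.m<m+n _ (subst (0 <_) (eq L) (s≤s z≤n))) h)
  where
  eq : ∀ L → suc (11 + 4 * L) ≡ 4 * (L + 3)
  eq = solve-∀

beaten₈ : ∀ q L n → (4 + L) * (4 + q) + 4 * (L + 3) ≤ n * (4 + q) → ∃[ c ] Beaten (8 + q) L n c
beaten₈ q L n h with ℕ.m≤n⇒m<n∨m≡n (5+L≤n q L n h)
... | inj₂ refl  = 2 , beaten₈-tight q L h
-- The case assumption is exactly 2c + L ≤ n for c = 3, which fails at n = L + 5.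
... | inj₁ 6+L≤n with o , refl ← ℕ.m≤n⇒∃[o]m+o≡n 6+L≤n = 3 , beaten (s≤s (s≤s z≤n)) 6+L≤n
  (bound-linear (7 + q) L 2 (3 + L + o) (linear-< 1 5 h (eq q L (3 + L + o))))
  where
  eq : ∀ q L m → suc (1 * ((8 + q) * (3 * (3 + m + L)))) + (3 + m) * (4 + q) + 5
               ≡ 1 * (2 * (8 + q) * L + 2 * (8 + q) * 3 + 2 * (7 + q) * (2 * m + 1)) + ((4 + L) * (4 + q) + 4 * (L + 3))
  eq = solve-∀

-- Deletion bounds and the extremal graphs

module _ {r : ℕ} .{{_ : NonZero r}} (L m : ℕ) where

  -- The bound obtained by deleting i + 1 vertices of degree i + L.  It is
  -- convex in i, so it is largest at an end of the range.
  deletionBound : ℕ → ℕ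
  deletionBound i = suc i * (i + L) + turánSize r (m ∸ i)

  -- The difference of the Turán numbers of m - i and m - i - 1 vertices, for i < m: what
  -- `deletionBound` loses in its second term from i to i + 1.
  gain : ℕ → ℕ
  gain i = m ∸ suc i ∸ (m ∸ suc i) / r

  deletionBound-suc : ∀ {i} → i < m → deletionBound (suc i) + gain i ≡ deletionBound i + (2 * i + 2 + L)
  deletionBound-suc {i} i<m = trans (rearrange i L (turánSize r (m ∸ suc i)) (gain i))
    (cong (λ a → suc i * (i + L) + turánSize r a + (2 * i + 2 + L)) (sym (ℕ.+-∸-assoc 1 i<m)))
    where
    rearrange : ∀ i L t g → (2 + i) * (suc i + L) + t + g ≡ suc i * (i + L) + (t + g) + (2 * i + 2 + L)
    rearrange = solve-∀

  Drop : ℕ → Set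
  Drop i = 2 * i + 2 + L < gain i

  -- This is the convexity: the increase 2i + 2 + L of the first term grows with i, while `gain`
  -- does not.
  drop-earlier : ∀ {i j} → i ≤ j → Drop j → Drop i
  drop-earlier {i} {j} i≤j dropⱼ = begin-strict
    2 * i + 2 + L   ≤⟨ ℕ.+-monoˡ-≤ L (ℕ.+-monoˡ-≤ 2 (ℕ.*-monoʳ-≤ 2 i≤j)) ⟩
    2 * j + 2 + L   <⟨ dropⱼ ⟩
    gain j          ≤⟨ ∸/-mono-≤ r (ℕ.∸-monoʳ-≤ m (s≤s i≤j)) ⟩
    gain i          ∎
    where open ≤-Reasoning

  drop⇒< : ∀ {i} → i < m → Drop i → deletionBound (suc i) < deletionBound i
  drop⇒< {i} i<m drop = ℕ.+-cancelʳ-< (gain i) _ _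
    (subst (_< deletionBound i + gain i) (sym (deletionBound-suc i<m)) (ℕ.+-monoʳ-< (deletionBound i) drop))

  ¬drop⇒≤ : ∀ {i} → i < m → ¬ Drop i → deletionBound i ≤ deletionBound (suc i)
  ¬drop⇒≤ {i} i<m ¬drop = ℕ.+-cancelʳ-≤ (gain i) _ _
    (subst (deletionBound i + gain i ≤_) (sym (deletionBound-suc i<m)) (ℕ.+-monoʳ-≤ (deletionBound i) (ℕ.≮⇒≥ ¬drop)))

  decreasing : ∀ i → i < m → Drop i → deletionBound (suc i) < deletionBound 0
  decreasing zero    i<m drop = drop⇒< i<m drop
  decreasing (suc i) i<m drop = ℕ.<-trans (drop⇒< i<m drop)
    (decreasing i (ℕ.<-trans ≤-refl i<m) (drop-earlier (ℕ.n≤1+n i) drop))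

  increasing : ∀ {i d} → i ℕ.≤′ d → d ≤ m → ¬ Drop i → deletionBound i ≤ deletionBound d
  increasing ℕ.≤′-refl            _   _     = ≤-refl
  increasing (ℕ.≤′-step {d} i≤d) d<m ¬drop = ≤-trans (increasing i≤d (ℕ.<⇒≤ d<m) ¬drop)
    (¬drop⇒≤ d<m (λ drop → ¬drop (drop-earlier (ℕ.≤′⇒≤ i≤d) drop)))

  module _ {d : ℕ} (d≤m : d ≤ m) (end : deletionBound d < deletionBound 0) where

    -- Without an initial drop, convexity would make the sequence nondecreasing up to `d`, against
    -- `end`.
    drop₀ : Drop 0
    drop₀ with 2 * 0 + 2 + L ℕ.<? gain 0
    ... | yes drop = drop
    ... | no ¬drop = ⊥-elim (ℕ.<⇒≱ end (increasing {0} (ℕ.≤⇒≤′ z≤n) d≤m ¬drop))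

    -- If step i drops, so do all earlier ones, and the value lies below the start; if not, no later
    -- step drops, and the value is at most that at `d`.
    interior : ∀ i → suc i ≤ d → deletionBound (suc i) < deletionBound 0
    interior i i<d with 2 * i + 2 + L ℕ.<? gain i
    ... | yes drop = decreasing i (≤-trans i<d d≤m) drop
    ... | no ¬drop = ℕ.≤-<-trans
      (increasing (ℕ.≤⇒≤′ i<d) d≤m (λ drop → ¬drop (drop-earlier (ℕ.n≤1+n i) drop))) end

module _ {r : ℕ} .{{_ : NonZero r}} {L m d : ℕ} (B : Beaten r L (suc m) (suc d)) where
  open Beaten B

  d≤m : d ≤ m
  d≤m = ℕ.s≤s⁻¹ (begin
    suc d               ≤⟨ ℕ.m≤n*m (suc d) 2 ⟩
    2 * suc d           ≤⟨ ℕ.m≤m+n (2 * suc d) L ⟩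
    2 * suc d + L       ≤⟨ 2c+L≤n ⟩
    suc m               ∎)
    where open ≤-Reasoning

  deletionBound₀ : deletionBound {r} L m 0 ≡ L + turánSize r m
  deletionBound₀ = cong (_+ turánSize r m) (ℕ.+-identityʳ L)

  -- The beaten inequality at k = d + L, which 2c + L ≤ n makes admissible.
  end-beaten : deletionBound {r} L m d < deletionBound {r} L m 0
  end-beaten = subst (deletionBound {r} L m d <_) (sym deletionBound₀) (bound (d + L) (begin
    2 + (d + L + (d + L))   ≡⟨ rearrange d L ⟩
    2 * suc d + L + L       ≤⟨ ℕ.+-monoˡ-≤ L 2c+L≤n ⟩
    suc m + L               ∎))
    where
    open ≤-Reasoning
    rearrange : ∀ d L → 2 + (d + L + (d + L)) ≡ 2 * suc d + L + L
    rearrange = solve-∀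

  -- Leaves room for an apex of degree L that avoids a smallest class; the strict first drop already
  -- contains it.
  L≤m∸m/r : L ≤ m ∸ m / r
  L≤m∸m/r = begin
    L                             ≤⟨ ℕ.m≤n+m L 2 ⟩
    2 + L                         ≤⟨ ℕ.<⇒≤ (drop₀ L m d≤m end-beaten) ⟩
    m ∸ 1 ∸ (m ∸ 1) / r           ≤⟨ ∸/-mono-≤ r (ℕ.m∸n≤m m 1) ⟩
    m ∸ m / r                     ∎
    where open ≤-Reasoning

  edgeBound : ∀ (G : Graph (suc m)) → CliqueFree (suc r) G →
    ∃[ k ] (0 < lowCount k G × suc k ≤ lowCount k G + L × 2 + (k + k) ≤ suc m + L) →
    e G ≤ L + turánSize r m ×
    (e G ≡ L + turánSize r m → ∃[ v ] (deg G v ≡ L × G ─ v ≅ turán r m))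
  edgeBound G free (k , 0<low , k<low+L , 2k+2≤) with k ℕ.≤? L
  ... | yes k≤L =
    let (v , dv≤k) = lowVertex G 0<low
        (e≤ , ≅turán) = turán-theorem r m (G ─ v) (cliqueFree-─ {G = G} v free)
        dv≤L = ≤-trans dv≤k k≤L
    in subst (_≤ L + turánSize r m) (sym (e-─ G v)) (+-mono-≤ dv≤L e≤)
     , λ eq → let (dv≡L , e≡) = +-squeeze dv≤L e≤ (trans (sym (e-─ G v)) eq) in v , dv≡L , ≅turán e≡
  -- Here k = L + 1 + o, so j = o + 2, and deleting j vertices is entry `suc o` of `deletionBound`.
  ... | no k≰L with o , refl ← ℕ.m≤n⇒∃[o]m+o≡n (ℕ.≰⇒> k≰L) =
    ℕ.<⇒≤ e< , λ eq → ⊥-elim (ℕ.<-irrefl eq e<)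
    where
    j≤low : 2 + o ≤ lowCount k G
    j≤low = ℕ.+-cancelʳ-≤ L _ _ (subst (_≤ lowCount k G + L) (cong (ℕ._+_ 2) (+-comm L o)) k<low+L)

    e< : e G < L + turánSize r m
    e< with suc o ℕ.≤? d
    ... | yes o<d = begin-strict
      e G                                                   ≤⟨ e≤lowVertices k (2 + o) G free j≤low ⟩
      (2 + o) * (suc L + o) + turánSize r (m ∸ suc o)       ≡⟨ cong (λ a → (2 + o) * suc a + turánSize r (m ∸ suc o)) (+-comm L o) ⟩
      deletionBound {r} L m (suc o)                         <⟨ interior L m d≤m end-beaten o o<d ⟩
      deletionBound {r} L m 0                               ≡⟨ deletionBound₀ ⟩
      L + turánSize r m                                     ∎
      where open ≤-Reasoning
    -- More than c = d + 1 low vertices are available; only c of them are deleted.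
    ... | no o≮d = ℕ.≤-<-trans
      (e≤lowVertices k (suc d) G free (≤-trans (ℕ.m≤n⇒m≤1+n (ℕ.≰⇒> o≮d)) j≤low))
      (bound k 2k+2≤)

-- Construction of an extremal graph

subfamily : ∀ {n} (p : Fin n → Bool) c → c ≤ count p →
            ∃[ b ] ((∀ i → b i ≡ true → p i ≡ true) × count b ≡ c)
subfamily {zero}  p zero    _ = p , (λ ()) , refl
subfamily {suc n} p zero    _ = (λ _ → false) , (λ _ ()) , trans (sum-const (suc n)) (ℕ.*-zeroʳ (suc n))
subfamily {suc n} p (suc c) c<count with p zero in p₀
... | true  = let (b , b⇒p , count-b) = subfamily (p ∘ suc) c (ℕ.s≤s⁻¹ c<count) in
  (λ { zero → true ; (suc i) → b i }) , (λ { zero _ → p₀ ; (suc i) → b⇒p i }) , cong suc count-b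
... | false = let (b , b⇒p , count-b) = subfamily (p ∘ suc) (suc c) c<count in
  (λ { zero → false ; (suc i) → b i }) , (λ { (suc i) → b⇒p i }) , count-b

addVertex : ∀ {m} → Graph m → (Fin m → Bool) → Graph (suc m)
addVertex {m} H b = record { adj = adj′ ; adj-sym = sym′ ; adj-irrefl = irrefl′ }
  where
  adj′ : Fin (suc m) → Fin (suc m) → Bool
  adj′ zero    zero    = false
  adj′ zero    (suc y) = b y
  adj′ (suc x) zero    = b x
  adj′ (suc x) (suc y) = adj H x y

  sym′ : ∀ u v → adj′ u v ≡ adj′ v u
  sym′ zero    zero    = refl
  sym′ zero    (suc y) = refl
  sym′ (suc x) zero    = refl
  sym′ (suc x) (suc y) = adj-sym H x y

  irrefl′ : ∀ u → adj′ u u ≡ false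
  irrefl′ zero    = refl
  irrefl′ (suc x) = adj-irrefl H x

colourable⇒cliqueFree : ∀ {r n} (G : Graph n) (colour : Fin n → Fin r) →
                        (∀ u v → adj G u v ≡ true → colour u ≢ colour v) → CliqueFree (suc r) G
colourable⇒cliqueFree G colour proper (f , _ , f-hom) with pigeonhole ≤-refl (colour ∘ f)
... | i , j , i<j , same = proper (f i) (f j) (T⇒≡true (f-hom i j (≡true⇒T
  (cong not (dec-false (i ≟ j) (λ { refl → ℕ.<-irrefl refl i<j })))))) same

-- Residue r - 1 never occurs in the incomplete block, so its class has exactly ⌊m/r⌋ members. The
-- new vertex gets that colour and any L neighbours outside the class, which leaves an r-colouring.
extremal : ∀ r L m .{{_ : NonZero r}} → L ≤ m ∸ m / r →
           ∃[ G ] (CliqueFree (suc r) G × deg G zero ≡ L × G ─ zero ≅ turán r m)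
extremal r@(suc r′) L m L≤ = G , colourable⇒cliqueFree G colour proper , deg-zero , ≅-pointwise {G = G ─ zero} {turán r m} (λ _ _ → refl)
  where
  last : Fin r
  last = fromℕ r′

  inLast : Fin m → Bool
  inLast y = does (toℕ y mod r ≟ last)

  size-last : count inLast ≡ m / r
  size-last = trans (classSize≡ last m) (trans
    (cong (λ b → m / r + 𝟙 b) (¬-not λ last<s →
      ℕ.<⇒≱ (subst (_< m % r) (toℕ-fromℕ r′) (ℕ.<ᵇ⇒< _ _ (≡true⇒T last<s))) (ℕ.s≤s⁻¹ (m%n<n m r))))
    (ℕ.+-identityʳ (m / r)))

  L≤count : L ≤ count (not ∘ inLast)
  L≤count = begin
    L                                                     ≤⟨ L≤ ⟩
    m ∸ m / r                                             ≡⟨ cong₂ _∸_ (count-not inLast) size-last ⟨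
    count inLast + count (not ∘ inLast) ∸ count inLast    ≡⟨ ℕ.m+n∸m≡n (count inLast) _ ⟩
    count (not ∘ inLast)                                  ∎
    where open ≤-Reasoning

  chosen = subfamily (not ∘ inLast) L L≤count

  joined : Fin m → Bool
  joined = proj₁ chosen

  G : Graph (suc m)
  G = addVertex (turán r m) joined

  deg-zero : deg G zero ≡ L
  deg-zero = trans (deg≡count G zero) (proj₂ (proj₂ chosen))

  colour : Fin (suc m) → Fin r
  colour zero    = last
  colour (suc y) = toℕ y mod r

  joined⇒≢last : ∀ y → joined y ≡ true → toℕ y mod r ≢ last
  joined⇒≢last y vy y≡last with () ← trans (sym (proj₁ (proj₂ chosen) y vy)) (cong not (dec-true (toℕ y mod r ≟ last) y≡last))

  proper : ∀ u v → adj G u v ≡ true → colour u ≢ colour v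
  proper zero    (suc y) vy eq = joined⇒≢last y vy (sym eq)
  proper (suc x) zero    vx eq = joined⇒≢last x vx eq
  proper (suc x) (suc y) xy eq with () ← trans (sym xy) (cong not (dec-true (toℕ x mod r ≟ toℕ y mod r) eq))

-- Integer and rational hypotheses

-- Writing ℓ as `pred (+ L)` lets all later arithmetic take place in the natural numbers.
≥-1⇒pred : ∀ {ℓ} → ℓ ℤ.≥ -1ℤ → ∃[ L ] ℓ ≡ ℤ.pred (+ L)
≥-1⇒pred {+ l}        _ = suc l , refl
≥-1⇒pred { -[1+ 0 ]}  _ = 0 , refl
≥-1⇒pred { -[1+ suc _ ]} (ℤ.-≤- ())

pred+1 : ∀ L → ℤ.pred (+ L) ℤ.+ + 1 ≡ + L
pred+1 L = eq (+ L)
  where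
  eq : ∀ x → -1ℤ ℤ.+ x ℤ.+ + 1 ≡ x
  eq = ℤ-Solver.solve-∀

affine : ∀ a b L → + a ℤ.* ℤ.pred (+ L) ℤ.+ + (a + b) ≡ + (a * L + b)
affine a b L = trans (eq (+ a) (+ b) (+ L)) (cong (ℤ._+ + b) (sym (ℤ.pos-* a L)))
  where
  eq : ∀ x y z → x ℤ.* (-1ℤ ℤ.+ z) ℤ.+ (x ℤ.+ y) ≡ x ℤ.* z ℤ.+ y
  eq = ℤ-Solver.solve-∀

shift : ∀ a L → ℤ.pred (+ L) ℤ.+ + suc a ≡ + (a + L)
shift a L = trans (eq (+ a) (+ L)) refl
  where
  eq : ∀ x z → -1ℤ ℤ.+ z ℤ.+ (+ 1 ℤ.+ x) ≡ x ℤ.+ z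
  eq = ℤ-Solver.solve-∀

clear-denominator : ∀ {x y n a b} d .{{_ : NonZero d}} → x ≡ + a → y ≡ + b →
                    fromℤ x ℚ.+ y ℚ./ d ℚ.≤ fromℤ (+ n) → a * d + b ≤ n * d
-- The order on unnormalised rationals is cross-multiplication, so matching exposes an integer
-- inequality.
clear-denominator {n = n} {a} {b} d@(suc _) refl refl (*≤* h) = ℤ.drop‿+≤+ (subst₂ ℤ._≤_ left right h)
  where
  left : (+ a ℤ.* + d ℤ.+ + b ℤ.* + 1) ℤ.* + 1 ≡ + (a * d + b)
  left = trans (ℤ.*-identityʳ _) (cong₂ ℤ._+_ (sym (ℤ.pos-* a d)) (ℤ.*-identityʳ (+ b)))

  right : + n ℤ.* + (1 * d) ≡ + (n * d)
  right = trans (cong (λ c → + n ℤ.* + c) (ℕ.*-identityˡ d)) (sym (ℤ.pos-* n d))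

>-∸ : ∀ a L n → + n ℤ.> + a ℤ.- ℤ.pred (+ L) → suc a < n + L
>-∸ a L n h = ℤ.drop‿+<+ (subst (ℤ._< + (n + L)) (eq (+ a) (+ L)) (ℤ.+-monoˡ-< (+ L) h))
  where
  eq : ∀ x z → x ℤ.- (-1ℤ ℤ.+ z) ℤ.+ z ≡ + 1 ℤ.+ x
  eq = ℤ-Solver.solve-∀

⊓-< : ∀ i j {k} → i ℤ.⊓ j ℤ.< k → i ℤ.< k ⊎ j ℤ.< k
⊓-< i j i⊓j<k with ℤ.⊓-sel i j
... | inj₁ eq = inj₁ (subst (ℤ._< _) eq i⊓j<k)
... | inj₂ eq = inj₂ (subst (ℤ._< _) eq i⊓j<k)

large : ∀ r L n → .{{_ : NonZero (r ∸ 3)}} .{{_ : NonZero (2 * r ∸ 2)}} → 4 ≤ r → r ≤ 7 →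
        LargeEnough (ℤ.pred (+ L)) r n → Large r L n
large r L n 4≤r r≤7 le =
    clear-denominator (r ∸ 3) (trans (ℤ.+-comm (+ 3) ℓ) (shift 2 L)) four (ℚ.≤-trans (ℚ.p≤p⊔q x y) x⊔y≤n)
  , clear-denominator (2 * r ∸ 2) (trans (ℤ.+-comm (+ 5) ℓ) (shift 4 L)) rest (ℚ.≤-trans (ℚ.p≤q⊔p x y) x⊔y≤n)
  where
  ℓ = ℤ.pred (+ L)
  x = fromℤ (+ 3 ℤ.+ ℓ) ℚ.+ (+ 4 ℤ.* (ℓ ℤ.+ + 2)) ℚ./ (r ∸ 3)
  y = fromℤ (+ 5 ℤ.+ ℓ) ℚ.+ (+ r ℤ.+ + 2 ℤ.* ℓ ℤ.+ + 7) ℚ./ (2 * r ∸ 2)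
  x⊔y≤n = LargeEnough.4≤r≤7 le 4≤r r≤7

  four : + 4 ℤ.* (ℓ ℤ.+ + 2) ≡ + (4 * (L + 1))
  four = trans (cong (+ 4 ℤ.*_) (trans (shift 1 L) (cong +_ (+-comm 1 L)))) (sym (ℤ.pos-* 4 (L + 1)))

  rest : + r ℤ.+ + 2 ℤ.* ℓ ℤ.+ + 7 ≡ + (r + 2 * L + 5)
  rest = trans (ℤ.+-assoc (+ r) (+ 2 ℤ.* ℓ) (+ 7)) (trans (cong (ℤ._+_ (+ r)) (affine 2 5 L)) (cong +_ (sym (+-assoc r (2 * L) 5))))

notSmall : ∀ a b L n → (ℤ.pred (+ L) ≡ -1ℤ → n ℕ.> 5) →
           (ℤ.pred (+ L) ℤ.≥ + 0 → + n ℤ.> (+ a ℤ.- ℤ.pred (+ L)) ℤ.⊓ (+ b ℤ.* ℤ.pred (+ L) ℤ.+ + b)) →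
           NotSmall (suc a) b L n
notSmall a b zero      n n>5 _ = inj₁ (refl , n>5 refl)
notSmall a b L@(suc _) n _   h = inj₂ (s≤s z≤n , map (>-∸ a L n) bL<n (⊓-< (+ a ℤ.- ℤ.pred (+ L)) _ (h (ℤ.+≤+ z≤n))))
  where
  bL<n : + b ℤ.* ℤ.pred (+ L) ℤ.+ + b ℤ.< + n → b * L < n
  bL<n h = ℤ.drop‿+<+ (subst (ℤ._< + n) (trans (cong (λ c → + b ℤ.* ℤ.pred (+ L) ℤ.+ + c) (sym (ℕ.+-identityʳ b)))
    (trans (affine b 0 L) (cong +_ (ℕ.+-identityʳ (b * L))))) h)

numeric : ∀ L r n .{{_ : NonZero r}} → 3 ≤ r → LargeEnough (ℤ.pred (+ L)) r n → Exceptional (ℤ.pred (+ L)) r n →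
          ∃[ c ] Beaten r L n c
numeric L 3 n _ le _ = beaten₃ L n (ℤ.drop‿+≤+ (subst (ℤ._≤ + n) (affine 6 20 L) (LargeEnough.r≡3 le refl)))
numeric L 4 n _ le ex = beaten₄ L n
  (large 4 L n ≤-refl (ℕ.m≤m+n 4 3) le , >-∸ 13 L n (Exceptional.r≡4 ex refl))
numeric L 5 n _ le ex = beaten₅ L n
  ( large 5 L n (ℕ.m≤m+n 4 1) (ℕ.m≤m+n 5 2) le
  , notSmall 17 10 L n (λ ℓ≡-1 → Exceptional.ℓ≡-1∧5≤r≤7 ex ℓ≡-1 ≤-refl (ℕ.m≤m+n 5 2))
      (λ ℓ≥0 → Exceptional.ℓ≥0∧r≡5 ex ℓ≥0 refl) )
numeric L 6 n _ le ex = beaten₆ L n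
  ( large 6 L n (ℕ.m≤m+n 4 2) (ℕ.m≤m+n 6 1) le
  , notSmall 21 6 L n (λ ℓ≡-1 → Exceptional.ℓ≡-1∧5≤r≤7 ex ℓ≡-1 (ℕ.m≤m+n 5 1) (ℕ.m≤m+n 6 1))
      (λ ℓ≥0 → Exceptional.ℓ≥0∧6≤r≤7 ex ℓ≥0 ≤-refl (ℕ.m≤m+n 6 1)) )
numeric L 7 n _ le ex = beaten₇ L n
  ( large 7 L n (ℕ.m≤m+n 4 3) ≤-refl le
  , notSmall 25 6 L n (λ ℓ≡-1 → Exceptional.ℓ≡-1∧5≤r≤7 ex ℓ≡-1 (ℕ.m≤m+n 5 2) ≤-refl)
      (λ ℓ≥0 → Exceptional.ℓ≥0∧6≤r≤7 ex ℓ≥0 (ℕ.m≤m+n 6 1) ≤-refl) )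
numeric L (suc (suc (suc (suc (suc (suc (suc (suc q)))))))) n _ le _ = beaten₈ q L n
  (clear-denominator (4 + q) (shift 4 L) four (LargeEnough.8≤r le (ℕ.m≤m+n 8 q)))
  where
  four : + 4 ℤ.* (ℤ.pred (+ L) ℤ.+ + 4) ≡ + (4 * (L + 3))
  four = trans (cong (+ 4 ℤ.*_) (trans (shift 3 L) (cong +_ (+-comm 3 L)))) (sym (ℤ.pos-* 4 (L + 3)))
numeric L 0 n () _ _
numeric L 1 n (s≤s ()) _ _
numeric L 2 n (s≤s (s≤s ())) _ _

stableℕ : ∀ {p} {P : GraphProperty p} {n L} → Stable n (+ n ℤ.+ ℤ.pred (+ L)) P →
          ∀ (G : Graph n) u v (u≢v : u ≢ v) → adj G u v ≡ false → holds P (addEdge G u v u≢v) →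
          n + L ≤ suc (deg G u + deg G v) → holds P G
stableℕ {n = n} {L} stable G u v u≢v ¬uv PG+uv h =
  stable G u v u≢v (λ uv → subst T ¬uv uv) PG+uv
    (subst (ℤ._≤ + (deg G u + deg G v)) (eq (+ n) (+ L)) (ℤ.+-monoʳ-≤ -1ℤ (ℤ.+≤+ h)))
  where
  eq : ∀ x y → -1ℤ ℤ.+ (x ℤ.+ y) ≡ x ℤ.+ (-1ℤ ℤ.+ y)
  eq = ℤ-Solver.solve-∀

turánBound≡ : ∀ r m L .{{_ : NonZero r}} → turánBound r (suc m) (ℤ.pred (+ L)) ≡ + (L + turánSize r m)
turánBound≡ r m L = trans (cong₂ (λ a b → + a ℤ.+ b) (e-turán r m) (pred+1 L)) (cong +_ (+-comm (turánSize r m) L))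

-- The theorem with the hypotheses on n, r and ℓ = L - 1 reduced to their
-- only consequence that matters.
beaten⇒theorem : ∀ {p} (P : GraphProperty p) {r} .{{_ : NonZero r}} {L n c} → Beaten r L n c →
  Stable n (+ n ℤ.+ ℤ.pred (+ L)) P → holds P (K n) →
  ((G : Graph n) → CliqueFree (suc r) G → ¬ holds P G →
    (+ e G ℤ.≤ turánBound r n (ℤ.pred (+ L))) ×
    (+ e G ≡ turánBound r n (ℤ.pred (+ L)) → 𝒢 r (ℤ.pred (+ L)) G)) ×
  (∃[ G ] 𝒢 {n} r (ℤ.pred (+ L)) G) ×
  ((∃[ G ] (𝒢 {n} r (ℤ.pred (+ L)) G × ¬ holds P G)) →
    ∃[ G ] (CliqueFree {n} (suc r) G × ¬ holds P G × + e G ≡ turánBound r n (ℤ.pred (+ L))))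
beaten⇒theorem P {c = zero} (beaten () _ _)
beaten⇒theorem P {n = zero} {c = suc _} (beaten _ () _)
beaten⇒theorem P {r} {L} {suc m} {suc d} B stable PK = bounded , nonempty , tight
  where
  bounded : (G : Graph (suc m)) → CliqueFree (suc r) G → ¬ holds P G →
            (+ e G ℤ.≤ turánBound r (suc m) (ℤ.pred (+ L))) ×
            (+ e G ≡ turánBound r (suc m) (ℤ.pred (+ L)) → 𝒢 r (ℤ.pred (+ L)) G)
  bounded G free ¬PG =
    let low = ¬P⇒lowDegrees (holds P) L (holds-resp P) PK (stableℕ {P = P} stable) G ¬PG
        (e≤ , extremal-G) = edgeBound B G free low
    in subst (+ e G ℤ.≤_) (sym (turánBound≡ r m L)) (ℤ.+≤+ e≤)
     , λ e≡ → let (v , dv≡L , rest) = extremal-G (ℤ.+-injective (trans e≡ (turánBound≡ r m L)))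
              in record { cliqueFree = free ; apex = v ; apex-deg = trans (cong +_ dv≡L) (sym (pred+1 L)) ; rest = rest }

  nonempty : ∃[ G ] 𝒢 {suc m} r (ℤ.pred (+ L)) G
  nonempty = let (G , free , dv≡L , rest) = extremal r L m (L≤m∸m/r B)
    in G , record { cliqueFree = free ; apex = zero ; apex-deg = trans (cong +_ dv≡L) (sym (pred+1 L)) ; rest = rest }

  tight : ∃[ G ] (𝒢 {suc m} r (ℤ.pred (+ L)) G × ¬ holds P G) →
          ∃[ G ] (CliqueFree {suc m} (suc r) G × ¬ holds P G × + e G ≡ turánBound r (suc m) (ℤ.pred (+ L)))
  -- Deleting the apex removes L edges and leaves T_r(m), so the given graph attains the bound
  -- itself.
  tight (G , G∈𝒢 , ¬PG) = G , cliqueFree , ¬PG , trans (cong +_ (trans (e-─ G apex)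
      (cong₂ _+_ (ℤ.+-injective (trans apex-deg (pred+1 L))) (trans (e-≅ {G = G ─ apex} {turán r m} rest) (e-turán r m)))))
      (sym (turánBound≡ r m L))
    where open 𝒢 G∈𝒢

theorem2p18 : ∀ {p : Level} (ℓ : ℤ) → ℓ ℤ.≥ -1ℤ →
    (P : GraphProperty p) → [n+ ℓ ]-Stable P →
    (nP : ℤ) → HoldsOnCompleteFrom nP P →
    (r : ℕ) .{{_ : NonZero r}} → r ℕ.≥ 3 →
    (n : ℕ) → + n ℤ.≥ nP →
    LargeEnough ℓ r n → Exceptional ℓ r n →
    ((G : Graph n) → CliqueFree (suc r) G → ¬ holds P G →
    (+ e G ℤ.≤ turánBound r n ℓ) ×
    (+ e G ≡ turánBound r n ℓ → 𝒢 r ℓ G)) ×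
    (∃[ G ] 𝒢 {n} r ℓ G) ×
    ((∃[ G ] (𝒢 {n} r ℓ G × ¬ holds P G)) →
    ∃[ G ] (CliqueFree {n} (suc r) G × ¬ holds P G × + e G ≡ turánBound r n ℓ))
theorem2p18 ℓ ℓ≥-1 P stable nP PK r r≥3 n n≥nP le ex
  with L , refl ← ≥-1⇒pred ℓ≥-1 =
  beaten⇒theorem P (proj₂ (numeric L r n r≥3 le ex)) (stable n) (PK n n≥nP)
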